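{- Let $n, k$ be positive integers, let $r \in \{1,\dots,k\}$ and let $t$ be an integer with $k < t \le n-k$. Consider the algorithm SINGLE-REF with sampling threshold $t$ and reference rank $r$ for the $k$-secretary problem on $n$ items. For $j \in \{1,\dots,k\}$ let $p_1^{(j)}$ be the probability that SINGLE-REF accepts the best item $v_1$ as its $j$-th accepted item. Then the competitive ratio of SINGLE-REF equals \[ \frac{1}{k} \sum_{j=1}^{k} \gamma_j \, p_1^{(j)}, \qquad \text{where } \gamma_j = \begin{cases} r + 2(j-1) & \text{if } j \le k-r+1, \\ k & \text{otherwise.} \end{cases} \]
   Context: $k$-secretary problem: there are $n$ items with distinct positive values $v_1 > v_2 > \dots > v_n$; item $v_i$ has rank $i$. The items arrive one by one in an order given by a permutation drawn uniformly at random among all $n!$ permutations. An algorithm may accept at most $k$ items; the decision to accept or reject an item is made immediately and irrevocably when it arrives. Let $\mathrm{ALG}$ be the sum of accepted values and $\mathrm{OPT} = \sum_{i=1}^k v_i$. The competitive ratio of an algorithm (for given $n$, $k$) is the infimum over all such item sets of $\mathbb{E}[\mathrm{ALG}]/\mathrm{OPT}$. SINGLE-REF with parameters $t$ (sampling threshold) and $r$ (reference rank): reject the first $t-1$ items (sampling phase); let $s_r$ be the $r$-th best among these $t-1$ items; afterwards accept the first $k$ items (arriving at positions $\ge t$) that are better than $s_r$.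
   Formalization: The item values are taken to be rational rather than real, so the infimum defining the competitive ratio (and the epsilon in its characterization) ranges over rational item sets. -}

module Defs where

open import Data.Bool using (Bool; true; false; if_then_else_)
open import Data.Nat as ℕ using (ℕ; zero; suc; _∸_; _≤ᵇ_; _<ᵇ_; _≡ᵇ_)
open import Data.Nat.Base using (_!)
open import Data.List using (List; []; _∷_; map; foldr; concatMap; take; drop; applyUpTo; filter; length)
open import Data.Maybe using (Maybe; just; nothing)
open import Data.Product using (Σ; _×_; _,_)
open import Data.Rational as ℚ using (ℚ; 0ℚ; _≤_; _<_; _+_; _*_; _÷_; ≢-nonZero)
open import Data.Rational.Properties using (_≟_)
open import Relation.Nullary using (yes; no)
open import Data.Integer using (+_)

-- Items are identified with their ranks 1..n (rank 1 = best value).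
-- An arrival order is a permutation of the list [1, 2, ..., n].

ranks : ℕ → List ℕ
ranks n = applyUpTo suc n

insertEverywhere : {A : Set} → A → List A → List (List A)
insertEverywhere x []       = (x ∷ []) ∷ []
insertEverywhere x (y ∷ ys) = (x ∷ y ∷ ys) ∷ map (y ∷_) (insertEverywhere x ys)

permutations : {A : Set} → List A → List (List A)
permutations []       = [] ∷ []
permutations (x ∷ xs) = concatMap (insertEverywhere x) (permutations xs)

arrivalOrders : ℕ → List (List ℕ)
arrivalOrders n = permutations (ranks n)

insertℕ : ℕ → List ℕ → List ℕ
insertℕ x []       = x ∷ []
insertℕ x (y ∷ ys) = if x ≤ᵇ y then x ∷ y ∷ ys else y ∷ insertℕ x ys

sortℕ : List ℕ → List ℕ
sortℕ = foldr insertℕ []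

-- 0-based lookup with default 0 (never used under the hypotheses)
nthℕ : ℕ → List ℕ → ℕ
nthℕ _       []       = 0
nthℕ zero    (x ∷ xs) = x
nthℕ (suc i) (x ∷ xs) = nthℕ i xs

nthMaybe : ℕ → List ℕ → Maybe ℕ
nthMaybe _       []       = nothing
nthMaybe zero    (x ∷ xs) = just x
nthMaybe (suc i) (x ∷ xs) = nthMaybe i xs

acceptBetter : ℕ → ℕ → List ℕ → List ℕ
acceptBetter zero       s xs       = []
acceptBetter (suc b)    s []       = []
acceptBetter (suc b)    s (x ∷ xs) =
  if x <ᵇ s then x ∷ acceptBetter b s xs else acceptBetter (suc b) s xs

referenceRank : (t r : ℕ) → List ℕ → ℕ
referenceRank t r σ = nthℕ (r ∸ 1) (sortℕ (take (t ∸ 1) σ))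

singleRef : (k t r : ℕ) → List ℕ → List ℕ
singleRef k t r σ = acceptBetter k (referenceRank t r σ) (drop (t ∸ 1) σ)

-- total division (x / 0 := 0); only ever applied to positive divisors
_÷'_ : ℚ → ℚ → ℚ
p ÷' q with q ≟ 0ℚ
... | yes _   = 0ℚ
... | no q≢0  = _÷_ p q {{≢-nonZero q≢0}}

fromℕℚ : ℕ → ℚ
fromℕℚ m = (+ m) ℚ./ 1

sumℚ : List ℚ → ℚ
sumℚ = foldr _+_ 0ℚ

countB : {A : Set} → (A → Bool) → List A → ℕ
countB f []       = 0
countB f (x ∷ xs) = if f x then suc (countB f xs) else countB f xs

-- Instances of the k-secretary problem with n items: values
-- v 1 > v 2 > ... > v n > 0 (v i = value of the item of rank i).

record Values (n : ℕ) : Set where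
  field
    v          : ℕ → ℚ
    decreasing : ∀ i → 1 ℕ.≤ i → i ℕ.< n → v (suc i) < v i
    positive   : ∀ i → 1 ℕ.≤ i → i ℕ.≤ n → 0ℚ < v i
open Values public

-- An online algorithm for budget k is modelled by its accepted ranks
-- as a function of the arrival order.
Algorithm : Set
Algorithm = List ℕ → List ℕ

valueOf : {n : ℕ} → Values n → List ℕ → ℚ
valueOf V xs = sumℚ (map (v V) xs)

expectedALG : (n : ℕ) → Algorithm → Values n → ℚ
expectedALG n alg V =
  sumℚ (map (λ σ → valueOf V (alg σ)) (arrivalOrders n)) ÷' fromℕℚ (n !)

OPT : (n k : ℕ) → Values n → ℚ
OPT n k V = valueOf V (ranks k)

ratio : (n k : ℕ) → Algorithm → Values n → ℚ
ratio n k alg V = expectedALG n alg V ÷' OPT n k V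

IsCompetitiveRatio : (n k : ℕ) → Algorithm → ℚ → Set
IsCompetitiveRatio n k alg ρ =
  ((V : Values n) → ρ ≤ ratio n k alg V) ×
  ((ε : ℚ) → 0ℚ < ε → Σ (Values n) (λ V → ratio n k alg V < ρ + ε))

isJthBest : ℕ → List ℕ → Bool
isJthBest j acc with nthMaybe (j ∸ 1) acc
... | just x  = x ≡ᵇ 1
... | nothing = false

p₁ : (n k t r j : ℕ) → ℚ
p₁ n k t r j =
  fromℕℚ (countB (λ σ → isJthBest j (singleRef k t r σ)) (arrivalOrders n))
    ÷' fromℕℚ (n !)

γ : (k r j : ℕ) → ℕ
γ k r j = if j ≤ᵇ (k ∸ r ℕ.+ 1) then r ℕ.+ 2 ℕ.* (j ∸ 1) else k

formula : (n k t r : ℕ) → ℚ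
formula n k t r =
  sumℚ (map (λ j → fromℕℚ (γ k r j) * p₁ n k t r j) (ranks k)) ÷' fromℕℚ k

module Submission where

-- Condition on the rank m of the reference item. Exchanging two adjacent values better than
-- the reference permutes the arrival orders and preserves m, so the j-th accepted item is equally
-- likely to be each of the ranks 1, …, m − 1; since exactly m − r items after the sample
-- beat the reference, item x < m is accepted as j-th item with a weight w m depending neither
-- on x nor on j, as long as r + j ≤ m. The total value of all runs is therefore
-- Σ_m w m · #{j ≤ k : r + j ≤ m} · Σ_{x < m} v x. As averages of prefixes of v decrease,
-- Σ_{x < m} v x ≥ (min k (m − 1) / k) · OPT, with near equality when the top k values are almost
-- equal and the others almost 0. The γ_j satisfy
-- Σ_{j ≤ k, r + j ≤ m} γ_j = min k (m − r) · min k (m − 1), which gives the formula.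

-- Item 1 alone determines the ratio because it beats every reference that lets anything be
-- accepted: `n !` times `p₁` at position j is the sum of w m over all m ≥ r + j, with no further
-- condition. The numbers w m are never evaluated; the argument rests on their being non-negative
-- and on the count of runs factoring into a part in x, a part in j and w m.
--
-- The constants `γ` come from a telescoping sum. If the last usable position is J = m - r ≤ k, then
-- m - 1 = J + r - 1, and the identity in the overview asks that the first J weights add up to J ·
-- min k (J + r - 1). The increment of this expression from J - 1 to J is r + 2(J - 1) as long as J
-- + r - 1 ≤ k, and k from then on. This is also where the threshold k - r + 1 comes from.
--
-- The instance with top values exactly 1 and all others 0 would turn the averaging inequality into
-- an equality, but values have to be positive and strictly decreasing. So the infimum is shown by a
-- bound for all instances and a perturbed family with a parameter δ tending to 0.

open import Defs
open import Data.Bool.Properties using (T-≡)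
open import Data.Bool using (Bool; true; false; if_then_else_; _∧_; T)
open import Data.Empty using (⊥-elim)
open import Data.Integer as ℤ using (+_)
import Data.Integer.Properties as ℤ
open import Data.List using (List; []; _∷_; _++_; map; concatMap; take; drop; applyUpTo; length)
open import Data.List.Properties using (map-∘; map-concatMap; concatMap-map; concatMap-cong; map-applyUpTo; applyUpTo-∷ʳ; take-map; drop-map; take++drop≡id; length-take; length-applyUpTo)
open import Data.List.Membership.Propositional using (_∈_; find)
open import Data.List.Membership.Propositional.Properties using (∈-concatMap⁻; ∈-map⁻; ∈-applyUpTo⁻)
open import Data.List.Relation.Binary.Permutation.Propositional using (_↭_; refl; prep; swap; trans; ↭-refl; ↭-sym; ↭-trans)
open import Data.List.Relation.Binary.Permutation.Propositional.Properties using (All-resp-↭; ∈-resp-↭; ↭-length; map⁺)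
open import Data.List.Relation.Unary.All as All using (All; []; _∷_)
import Data.List.Relation.Unary.All.Properties as All
open import Data.List.Relation.Unary.AllPairs using (AllPairs; []; _∷_)
open import Data.List.Relation.Unary.Any using (here; there)
open import Data.Maybe as Maybe using (Maybe; just; nothing)
open import Data.Nat using (ℕ; zero; suc; _≤_; _<_; _∸_; _+_; _*_; _⊓_; _≤ᵇ_; _<ᵇ_; _≡ᵇ_; _!; z≤n; s≤s; _≤?_; _<?_; _≟_)
open import Data.Nat.Properties as ℕ using (≤-refl; ≤-trans; ≤⇒≤ᵇ; ≤ᵇ⇒≤; ≮⇒≥; ≰⇒>)
import Data.Nat.Solver as ℕ-Solver
open import Data.Product using (Σ; _×_; _,_; proj₁; proj₂)
open import Data.Rational as ℚ using (ℚ; 0ℚ; 1ℚ; nonNegative; toℚᵘ)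
import Data.Rational.Properties as ℚ
open import Data.Rational.Solver using (module +-*-Solver)
open import Data.Rational.Unnormalised as ℚᵘ using (mkℚᵘ)
import Data.Rational.Unnormalised.Properties as ℚᵘ
open import Data.Sum using (inj₁; inj₂)
open import Data.Unit using (tt)
open import Function using (_∘_; id; Equivalence)
open import Relation.Binary.PropositionalEquality using (_≡_; _≢_; refl; sym; cong; cong₂; subst; module ≡-Reasoning) renaming (trans to ≡-trans)
open import Relation.Nullary using (¬_; yes; no; contradiction)

private
  variable
    A B : Set

-- Finite sums of rationals

∑ : List A → (A → ℚ) → ℚ
∑ xs f = sumℚ (map f xs)

∑-++ : ∀ (xs : List A) {ys} (f : A → ℚ) → ∑ (xs ++ ys) f ≡ ∑ xs f ℚ.+ ∑ ys f
∑-++ []       f = sym (ℚ.+-identityˡ _)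
∑-++ (x ∷ xs) f = ≡-trans (cong (f x ℚ.+_) (∑-++ xs f)) (sym (ℚ.+-assoc (f x) _ _))

∑-map : ∀ (g : A → B) (xs : List A) (f : B → ℚ) → ∑ (map g xs) f ≡ ∑ xs (f ∘ g)
∑-map g xs f = cong sumℚ (sym (map-∘ xs))

∑-concatMap : ∀ (g : A → List B) (xs : List A) (f : B → ℚ) →
  ∑ (concatMap g xs) f ≡ ∑ xs (λ x → ∑ (g x) f)
∑-concatMap g []       f = refl
∑-concatMap g (x ∷ xs) f =
  ≡-trans (∑-++ (g x) f) (cong (∑ (g x) f ℚ.+_) (∑-concatMap g xs f))

∑-cong-∈ : ∀ (xs : List A) {f g : A → ℚ} → (∀ {x} → x ∈ xs → f x ≡ g x) → ∑ xs f ≡ ∑ xs g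
∑-cong-∈ []       eq = refl
∑-cong-∈ (x ∷ xs) eq = cong₂ ℚ._+_ (eq (here refl)) (∑-cong-∈ xs (eq ∘ there))

∑-cong : ∀ (xs : List A) {f g : A → ℚ} → (∀ x → f x ≡ g x) → ∑ xs f ≡ ∑ xs g
∑-cong xs eq = ∑-cong-∈ xs (λ {x} _ → eq x)

∑-mono-∈ : ∀ (xs : List A) {f g : A → ℚ} → (∀ {x} → x ∈ xs → f x ℚ.≤ g x) → ∑ xs f ℚ.≤ ∑ xs g
∑-mono-∈ []       le = ℚ.≤-refl
∑-mono-∈ (x ∷ xs) le = ℚ.+-mono-≤ (le (here refl)) (∑-mono-∈ xs (le ∘ there))

∑-zero : ∀ (xs : List A) → ∑ xs (λ _ → 0ℚ) ≡ 0ℚ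
∑-zero []       = refl
∑-zero (x ∷ xs) = ≡-trans (ℚ.+-identityˡ _) (∑-zero xs)

∑-nonneg : ∀ (xs : List A) {f : A → ℚ} → (∀ {x} → x ∈ xs → 0ℚ ℚ.≤ f x) → 0ℚ ℚ.≤ ∑ xs f
∑-nonneg xs {f} le = subst (ℚ._≤ ∑ xs f) (∑-zero xs) (∑-mono-∈ xs le)

∑-distrib-+ : ∀ (xs : List A) (f g : A → ℚ) → ∑ xs (λ x → f x ℚ.+ g x) ≡ ∑ xs f ℚ.+ ∑ xs g
∑-distrib-+ []       f g = refl
∑-distrib-+ (x ∷ xs) f g =
  ≡-trans (cong ((f x ℚ.+ g x) ℚ.+_) (∑-distrib-+ xs f g))
        (solve 4 (λ a b c d → ((a :+ b) :+ (c :+ d)) := ((a :+ c) :+ (b :+ d))) refl (f x) (g x) _ _)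
  where
  open +-*-Solver

∑-distribˡ-* : ∀ (xs : List A) (c : ℚ) (f : A → ℚ) → c ℚ.* ∑ xs f ≡ ∑ xs (λ x → c ℚ.* f x)
∑-distribˡ-* []       c f = ℚ.*-zeroʳ c
∑-distribˡ-* (x ∷ xs) c f =
  ≡-trans (ℚ.*-distribˡ-+ c (f x) _) (cong (c ℚ.* f x ℚ.+_) (∑-distribˡ-* xs c f))

∑-distribʳ-* : ∀ (xs : List A) (f : A → ℚ) (c : ℚ) → ∑ xs f ℚ.* c ≡ ∑ xs (λ x → f x ℚ.* c)
∑-distribʳ-* xs f c =
  ≡-trans (ℚ.*-comm _ c) (≡-trans (∑-distribˡ-* xs c f) (∑-cong xs (λ x → ℚ.*-comm c (f x))))

∑-swap : ∀ (xs : List A) (ys : List B) (f : A → B → ℚ) →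
  ∑ xs (λ x → ∑ ys (f x)) ≡ ∑ ys (λ y → ∑ xs (λ x → f x y))
∑-swap []       ys f = sym (∑-zero ys)
∑-swap (x ∷ xs) ys f =
  ≡-trans (cong (∑ ys (f x) ℚ.+_) (∑-swap xs ys f)) (sym (∑-distrib-+ ys (f x) _))

∑-↭ : ∀ {xs ys : List A} (f : A → ℚ) → xs ↭ ys → ∑ xs f ≡ ∑ ys f
∑-↭ f refl         = refl
∑-↭ f (prep x p)   = cong (f x ℚ.+_) (∑-↭ f p)
∑-↭ f (swap x y p) =
  ≡-trans (cong (λ s → f x ℚ.+ (f y ℚ.+ s)) (∑-↭ f p))
        (solve 3 (λ a b c → (a :+ (b :+ c)) := (b :+ (a :+ c))) refl (f x) (f y) _)
  where
  open +-*-Solver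
∑-↭ f (trans p q)  = ≡-trans (∑-↭ f p) (∑-↭ f q)

ind : Bool → ℚ
ind b = if b then 1ℚ else 0ℚ

ind-T : ∀ {b} → T b → ind b ≡ 1ℚ
ind-T {true} _ = refl

ind-¬T : ∀ {b} → ¬ T b → ind b ≡ 0ℚ
ind-¬T {false} _  = refl
ind-¬T {true}  ¬t = ⊥-elim (¬t tt)

0≤ind : ∀ b → 0ℚ ℚ.≤ ind b
0≤ind true  = ℚ.nonNegative⁻¹ 1ℚ
0≤ind false = ℚ.≤-refl

ind≤1 : ∀ b → ind b ℚ.≤ 1ℚ
ind≤1 true  = ℚ.≤-refl
ind≤1 false = ℚ.nonNegative⁻¹ 1ℚ

ind-∧ : ∀ a b → ind (a ∧ b) ≡ ind a ℚ.* ind b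
ind-∧ true  b = sym (ℚ.*-identityˡ (ind b))
ind-∧ false b = sym (ℚ.*-zeroˡ (ind b))

-- Embedding of the natural numbers, and clearing of denominators

private
  toℚᵘ-fromℕℚ : ∀ m → toℚᵘ (fromℕℚ m) ℚᵘ.≃ mkℚᵘ (+ m) 0
  toℚᵘ-fromℕℚ m = ℚ.toℚᵘ-fromℚᵘ (mkℚᵘ (+ m) 0)

fromℕℚ-+ : ∀ m n → fromℕℚ (m + n) ≡ fromℕℚ m ℚ.+ fromℕℚ n
fromℕℚ-+ m n = ℚ.toℚᵘ-injective (begin-equality
  toℚᵘ (fromℕℚ (m + n))                ≃⟨ toℚᵘ-fromℕℚ (m + n) ⟩
  mkℚᵘ (+ (m + n)) 0                   ≃⟨ ℚᵘ.*≡* (cong₂ ℤ._*_ (cong₂ ℤ._+_ (sym (ℤ.*-identityʳ (+ m))) (sym (ℤ.*-identityʳ (+ n)))) refl) ⟩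
  mkℚᵘ (+ m) 0 ℚᵘ.+ mkℚᵘ (+ n) 0       ≃⟨ ℚᵘ.+-cong (toℚᵘ-fromℕℚ m) (toℚᵘ-fromℕℚ n) ⟨
  toℚᵘ (fromℕℚ m) ℚᵘ.+ toℚᵘ (fromℕℚ n) ≃⟨ ℚ.toℚᵘ-homo-+ (fromℕℚ m) (fromℕℚ n) ⟨
  toℚᵘ (fromℕℚ m ℚ.+ fromℕℚ n)         ∎)
  where
  open ℚᵘ.≤-Reasoning

fromℕℚ-suc : ∀ n → fromℕℚ (suc n) ≡ fromℕℚ n ℚ.+ 1ℚ
fromℕℚ-suc n = ≡-trans (fromℕℚ-+ 1 n) (ℚ.+-comm 1ℚ (fromℕℚ n))

fromℕℚ-* : ∀ m n → fromℕℚ (m * n) ≡ fromℕℚ m ℚ.* fromℕℚ n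
fromℕℚ-* zero    n = sym (ℚ.*-zeroˡ (fromℕℚ n))
fromℕℚ-* (suc m) n = begin
  fromℕℚ (n + m * n)                          ≡⟨ fromℕℚ-+ n (m * n) ⟩
  fromℕℚ n ℚ.+ fromℕℚ (m * n)                 ≡⟨ cong (fromℕℚ n ℚ.+_) (fromℕℚ-* m n) ⟩
  fromℕℚ n ℚ.+ fromℕℚ m ℚ.* fromℕℚ n          ≡⟨ solve 2 (λ a b → (b :+ (a :* b)) := ((a :+ con 1ℚ) :* b)) refl (fromℕℚ m) (fromℕℚ n) ⟩
  (fromℕℚ m ℚ.+ 1ℚ) ℚ.* fromℕℚ n              ≡⟨ cong (ℚ._* fromℕℚ n) (fromℕℚ-suc m) ⟨
  fromℕℚ (suc m) ℚ.* fromℕℚ n                 ∎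
  where
  open ≡-Reasoning
  open +-*-Solver

0≤fromℕℚ : ∀ n → 0ℚ ℚ.≤ fromℕℚ n
0≤fromℕℚ zero    = ℚ.≤-refl
0≤fromℕℚ (suc n) = subst (0ℚ ℚ.≤_) (sym (fromℕℚ-suc n)) (ℚ.+-mono-≤ (0≤fromℕℚ n) (ℚ.nonNegative⁻¹ 1ℚ))

0<fromℕℚ : ∀ {n} → 1 ≤ n → 0ℚ ℚ.< fromℕℚ n
0<fromℕℚ {suc n} _ = subst (0ℚ ℚ.<_) (sym (fromℕℚ-suc n)) (ℚ.+-mono-≤-< (0≤fromℕℚ n) (ℚ.positive⁻¹ 1ℚ))

countB-∑ : ∀ (f : A → Bool) (xs : List A) → fromℕℚ (countB f xs) ≡ ∑ xs (ind ∘ f)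
countB-∑ f []       = refl
countB-∑ f (x ∷ xs) with f x
... | true  = ≡-trans (fromℕℚ-+ 1 (countB f xs)) (cong (1ℚ ℚ.+_) (countB-∑ f xs))
... | false = ≡-trans (countB-∑ f xs) (sym (ℚ.+-identityˡ _))

-- Quotients are handled only through this cancellation: (in)equalities between ratios are first
-- multiplied by their positive denominators.
÷'-* : ∀ p {q} → 0ℚ ℚ.< q → (p ÷' q) ℚ.* q ≡ p
÷'-* p {q} 0<q with q ℚ.≟ 0ℚ
... | yes refl = contradiction 0<q (ℚ.<-irrefl refl)
... | no q≢0   = begin
  p ℚ.* ℚ.1/ q ℚ.* q   ≡⟨ ℚ.*-assoc p (ℚ.1/ q) q ⟩
  p ℚ.* (ℚ.1/ q ℚ.* q) ≡⟨ cong (p ℚ.*_) (ℚ.*-inverseˡ q) ⟩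
  p ℚ.* 1ℚ             ≡⟨ ℚ.*-identityʳ p ⟩
  p                    ∎
  where
  open ≡-Reasoning
  instance _ = ℚ.≢-nonZero q≢0

0≤* : ∀ {p q} → 0ℚ ℚ.≤ p → 0ℚ ℚ.≤ q → 0ℚ ℚ.≤ p ℚ.* q
0≤* {p} {q} 0≤p 0≤q = subst (ℚ._≤ p ℚ.* q) (ℚ.*-zeroˡ q) (ℚ.*-monoʳ-≤-nonNeg q ⦃ nonNegative 0≤q ⦄ 0≤p)

0<* : ∀ {p q} → 0ℚ ℚ.< p → 0ℚ ℚ.< q → 0ℚ ℚ.< p ℚ.* q
0<* {p} {q} 0<p 0<q = subst (ℚ._< p ℚ.* q) (ℚ.*-zeroˡ q) (ℚ.*-monoˡ-<-pos q ⦃ ℚ.positive 0<q ⦄ 0<p)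

-- Sums over an initial segment of ranks

∈-ranks⇒1≤ : ∀ {n x} → x ∈ ranks n → 1 ≤ x
∈-ranks⇒1≤ x∈ with ∈-applyUpTo⁻ suc x∈
... | _ , _ , refl = s≤s z≤n

∈-ranks⇒≤ : ∀ {n x} → x ∈ ranks n → x ≤ n
∈-ranks⇒≤ x∈ with ∈-applyUpTo⁻ suc x∈
... | _ , i<n , refl = i<n

∑-ranks-suc : ∀ n (f : ℕ → ℚ) → ∑ (ranks (suc n)) f ≡ ∑ (ranks n) f ℚ.+ f (suc n)
∑-ranks-suc n f = begin
  ∑ (ranks (suc n)) f             ≡⟨ cong (λ xs → ∑ xs f) (applyUpTo-∷ʳ suc n) ⟨
  ∑ (ranks n ++ suc n ∷ []) f     ≡⟨ ∑-++ (ranks n) f ⟩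
  ∑ (ranks n) f ℚ.+ (f (suc n) ℚ.+ 0ℚ) ≡⟨ cong (∑ (ranks n) f ℚ.+_) (ℚ.+-identityʳ (f (suc n))) ⟩
  ∑ (ranks n) f ℚ.+ f (suc n)     ∎
  where
  open ≡-Reasoning

∑-ranks-≤ᵇ : ∀ {k n} → k ≤ n → (f : ℕ → ℚ) → ∑ (ranks n) (λ x → ind (x ≤ᵇ k) ℚ.* f x) ≡ ∑ (ranks k) f
∑-ranks-≤ᵇ {k} {n} k≤n f with ℕ.m≤n⇒m<n∨m≡n k≤n
... | inj₂ refl = ∑-cong-∈ (ranks n) λ x∈ →
  ≡-trans (cong (ℚ._* f _) (ind-T (≤⇒≤ᵇ (∈-ranks⇒≤ x∈)))) (ℚ.*-identityˡ (f _))
∑-ranks-≤ᵇ {k} {suc n} k≤n f | inj₁ (s≤s k≤n′) = begin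
  ∑ (ranks (suc n)) (λ x → ind (x ≤ᵇ k) ℚ.* f x)
    ≡⟨ ∑-ranks-suc n _ ⟩
  ∑ (ranks n) (λ x → ind (x ≤ᵇ k) ℚ.* f x) ℚ.+ ind (suc n ≤ᵇ k) ℚ.* f (suc n)
    ≡⟨ cong₂ ℚ._+_ (∑-ranks-≤ᵇ k≤n′ f) (cong (ℚ._* f (suc n)) (ind-¬T (ℕ.<⇒≱ (s≤s k≤n′) ∘ ≤ᵇ⇒≤ (suc n) k))) ⟩
  ∑ (ranks k) f ℚ.+ 0ℚ ℚ.* f (suc n)
    ≡⟨ cong (∑ (ranks k) f ℚ.+_) (ℚ.*-zeroˡ (f (suc n))) ⟩
  ∑ (ranks k) f ℚ.+ 0ℚ
    ≡⟨ ℚ.+-identityʳ _ ⟩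
  ∑ (ranks k) f ∎
  where
  open ≡-Reasoning

∑-ranks-mono : ∀ {k n} → k ≤ n → {f : ℕ → ℚ} → (∀ {x} → x ∈ ranks n → 0ℚ ℚ.≤ f x) →
  ∑ (ranks k) f ℚ.≤ ∑ (ranks n) f
∑-ranks-mono {k} {n} k≤n {f} 0≤f = begin
  ∑ (ranks k) f                             ≡⟨ ∑-ranks-≤ᵇ k≤n f ⟨
  ∑ (ranks n) (λ x → ind (x ≤ᵇ k) ℚ.* f x)  ≤⟨ ∑-mono-∈ (ranks n) (λ {x} x∈ → ℚ.*-monoʳ-≤-nonNeg (f x) ⦃ nonNegative (0≤f x∈) ⦄ (ind≤1 (x ≤ᵇ k))) ⟩
  ∑ (ranks n) (λ x → 1ℚ ℚ.* f x)            ≡⟨ ∑-cong (ranks n) (λ x → ℚ.*-identityˡ (f x)) ⟩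
  ∑ (ranks n) f                             ∎
  where
  open ℚ.≤-Reasoning

∑-ranks-≡ᵇ : ∀ {a n} → 1 ≤ a → a ≤ n → (f : ℕ → ℚ) → ∑ (ranks n) (λ x → ind (a ≡ᵇ x) ℚ.* f x) ≡ f a
∑-ranks-≡ᵇ {suc a} _ (s≤s {n = n} a≤n) f = ≡-trans (cong sumℚ (map-applyUpTo suc (λ x → ind (suc a ≡ᵇ x) ℚ.* f x) (suc n))) (go a n a≤n (f ∘ suc))
  where
  go : ∀ a n → a ≤ n → (f : ℕ → ℚ) → sumℚ (applyUpTo (λ i → ind (a ≡ᵇ i) ℚ.* f i) (suc n)) ≡ f a
  go zero n _ f = begin
    1ℚ ℚ.* f 0 ℚ.+ sumℚ (applyUpTo (λ i → 0ℚ ℚ.* f (suc i)) n) ≡⟨ cong₂ ℚ._+_ (ℚ.*-identityˡ (f 0)) (cong sumℚ (sym (map-applyUpTo id (λ i → 0ℚ ℚ.* f (suc i)) n))) ⟩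
    f 0 ℚ.+ ∑ (applyUpTo id n) (λ i → 0ℚ ℚ.* f (suc i))        ≡⟨ cong (f 0 ℚ.+_) (∑-cong (applyUpTo id n) (λ i → ℚ.*-zeroˡ (f (suc i)))) ⟩
    f 0 ℚ.+ ∑ (applyUpTo id n) (λ _ → 0ℚ)                      ≡⟨ cong (f 0 ℚ.+_) (∑-zero (applyUpTo id n)) ⟩
    f 0 ℚ.+ 0ℚ                                                 ≡⟨ ℚ.+-identityʳ (f 0) ⟩
    f 0                                                        ∎
    where
    open ≡-Reasoning
  go (suc a) (suc n) (s≤s a≤n) f =
    ≡-trans (cong₂ ℚ._+_ (ℚ.*-zeroˡ (f 0)) (go a n a≤n (f ∘ suc))) (ℚ.+-identityˡ (f (suc a)))

-- Used for two counts: `c = r` gives the positions that get filled, and `c = 1` gives the ranks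
-- better than `m`, since `1 + x ≤ᵇ m` reduces to `x <ᵇ m`.
∑-ranks-shift≤ : ∀ c m k → ∑ (ranks k) (λ x → ind (c + x ≤ᵇ m)) ≡ fromℕℚ (k ⊓ (m ∸ c))
∑-ranks-shift≤ c m zero    = refl
∑-ranks-shift≤ c m (suc k) = ≡-trans (∑-ranks-suc k _) (≡-trans (cong (ℚ._+ ind (c + suc k ≤ᵇ m)) (∑-ranks-shift≤ c m k)) step)
  where
  step : fromℕℚ (k ⊓ (m ∸ c)) ℚ.+ ind (c + suc k ≤ᵇ m) ≡ fromℕℚ (suc k ⊓ (m ∸ c))
  step with c + suc k ≤? m
  ... | yes p = begin
    fromℕℚ (k ⊓ (m ∸ c)) ℚ.+ ind (c + suc k ≤ᵇ m) ≡⟨ cong₂ (λ a b → fromℕℚ a ℚ.+ b) (ℕ.m≤n⇒m⊓n≡m (≤-trans (ℕ.n≤1+n k) q)) (ind-T (≤⇒≤ᵇ p)) ⟩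
    fromℕℚ k ℚ.+ 1ℚ                               ≡⟨ fromℕℚ-suc k ⟨
    fromℕℚ (suc k)                                ≡⟨ cong fromℕℚ (ℕ.m≤n⇒m⊓n≡m q) ⟨
    fromℕℚ (suc k ⊓ (m ∸ c))                      ∎
    where
    open ≡-Reasoning
    q : suc k ≤ m ∸ c
    q = ℕ.m+n≤o⇒m≤o∸n (suc k) (subst (_≤ m) (ℕ.+-comm c (suc k)) p)
  ... | no ¬p = begin
    fromℕℚ (k ⊓ (m ∸ c)) ℚ.+ ind (c + suc k ≤ᵇ m) ≡⟨ cong₂ (λ a b → fromℕℚ a ℚ.+ b) (ℕ.m≥n⇒m⊓n≡n q) (ind-¬T (¬p ∘ ≤ᵇ⇒≤ _ m)) ⟩
    fromℕℚ (m ∸ c) ℚ.+ 0ℚ                         ≡⟨ ℚ.+-identityʳ _ ⟩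
    fromℕℚ (m ∸ c)                                ≡⟨ cong fromℕℚ (ℕ.m≥n⇒m⊓n≡n (ℕ.m≤n⇒m≤1+n q)) ⟨
    fromℕℚ (suc k ⊓ (m ∸ c))                      ∎
    where
    open ≡-Reasoning
    q : m ∸ c ≤ k
    q = ℕ.m≤n+o⇒m∸n≤o m c (ℕ.≤-pred (subst (suc m ≤_) (ℕ.+-suc c k) (≰⇒> ¬p)))

-- Counting over arrival orders

∈-insertEverywhere⇒↭ : ∀ {x : A} ys {σ} → σ ∈ insertEverywhere x ys → σ ↭ x ∷ ys
∈-insertEverywhere⇒↭ []       (here refl) = ↭-refl
∈-insertEverywhere⇒↭ (y ∷ ys) (here refl) = ↭-refl
∈-insertEverywhere⇒↭ {x = x} (y ∷ ys) (there p) with ∈-map⁻ (y ∷_) p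
... | _ , q , refl = ↭-trans (prep y (∈-insertEverywhere⇒↭ ys q)) (swap y x ↭-refl)

∈-permutations⇒↭ : ∀ (xs : List A) {σ} → σ ∈ permutations xs → σ ↭ xs
∈-permutations⇒↭ []       (here refl) = ↭-refl
∈-permutations⇒↭ (x ∷ xs) p with find (∈-concatMap⁻ (insertEverywhere x) p)
... | zs , zs∈ , σ∈ = ↭-trans (∈-insertEverywhere⇒↭ zs σ∈) (prep x (∈-permutations⇒↭ xs zs∈))

-- The results are sorted by which of `x` and `y` end up before the head `z`: both (two lists), only
-- `x` (`P x y`), only `y` (`P y x`), or none (`R`). The first three groups are symmetric as they
-- stand, and `R` is the induction hypothesis.
∑-insertEverywhere-comm : ∀ (x y : A) zs (f : List A → ℚ) →
  ∑ (insertEverywhere x zs) (λ w → ∑ (insertEverywhere y w) f) ≡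
  ∑ (insertEverywhere y zs) (λ w → ∑ (insertEverywhere x w) f)
∑-insertEverywhere-comm x y []       f =
  solve 2 (λ a b → (a :+ (b :+ con 0ℚ)) :+ con 0ℚ := (b :+ (a :+ con 0ℚ)) :+ con 0ℚ) refl
    (f (y ∷ x ∷ [])) (f (x ∷ y ∷ []))
  where
  open +-*-Solver
∑-insertEverywhere-comm {A} x y (z ∷ zs) f = begin
  L x y                                                         ≡⟨ expand x y ⟩
  (f (y ∷ x ∷ z ∷ zs) ℚ.+ (f (x ∷ y ∷ z ∷ zs) ℚ.+ P x y)) ℚ.+ (P y x ℚ.+ R x y)
    ≡⟨ solve 5 (λ a b p q r → (a :+ (b :+ p)) :+ (q :+ r) := (b :+ (a :+ q)) :+ (p :+ r)) refl
         (f (y ∷ x ∷ z ∷ zs)) (f (x ∷ y ∷ z ∷ zs)) (P x y) (P y x) (R x y) ⟩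
  (f (x ∷ y ∷ z ∷ zs) ℚ.+ (f (y ∷ x ∷ z ∷ zs) ℚ.+ P y x)) ℚ.+ (P x y ℚ.+ R x y)
    ≡⟨ cong (λ s → (f (x ∷ y ∷ z ∷ zs) ℚ.+ (f (y ∷ x ∷ z ∷ zs) ℚ.+ P y x)) ℚ.+ (P x y ℚ.+ s))
         (∑-insertEverywhere-comm x y zs (f ∘ (z ∷_))) ⟩
  (f (x ∷ y ∷ z ∷ zs) ℚ.+ (f (y ∷ x ∷ z ∷ zs) ℚ.+ P y x)) ℚ.+ (P x y ℚ.+ R y x)
    ≡⟨ expand y x ⟨
  L y x                                                         ∎
  where
  open ≡-Reasoning
  open +-*-Solver
  L P R : A → A → ℚ
  L x y = ∑ (insertEverywhere x (z ∷ zs)) (λ w → ∑ (insertEverywhere y w) f)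
  P x y = ∑ (insertEverywhere y zs) (λ w → f (x ∷ z ∷ w))
  R x y = ∑ (insertEverywhere x zs) (λ w → ∑ (insertEverywhere y w) (f ∘ (z ∷_)))
  expand : ∀ x y → L x y ≡
    (f (y ∷ x ∷ z ∷ zs) ℚ.+ (f (x ∷ y ∷ z ∷ zs) ℚ.+ P x y)) ℚ.+ (P y x ℚ.+ R x y)
  expand x y = cong₂ ℚ._+_
    (cong (λ s → f (y ∷ x ∷ z ∷ zs) ℚ.+ (f (x ∷ y ∷ z ∷ zs) ℚ.+ s))
      (≡-trans (∑-map (x ∷_) (map (z ∷_) (insertEverywhere y zs)) f)
               (∑-map (z ∷_) (insertEverywhere y zs) (f ∘ (x ∷_)))))
    (≡-trans (∑-map (z ∷_) (insertEverywhere x zs) (λ w → ∑ (insertEverywhere y w) f))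
      (≡-trans (∑-cong (insertEverywhere x zs)
                 (λ w → cong (f (y ∷ z ∷ w) ℚ.+_) (∑-map (z ∷_) (insertEverywhere y w) f)))
               (∑-distrib-+ (insertEverywhere x zs) (λ w → f (y ∷ z ∷ w)) _)))

-- A relabelling turns `ranks n` into a reordered list, whose permutations are enumerated in another
-- order. Stating the invariance for sums avoids building a permutation between two lists of lists.
∑-permutations-↭ : ∀ {xs ys : List A} → xs ↭ ys → (f : List A → ℚ) →
  ∑ (permutations xs) f ≡ ∑ (permutations ys) f
∑-permutations-↭ refl         f = refl
∑-permutations-↭ {xs = x ∷ xs} {ys = x ∷ ys} (prep x p)   f = begin
  ∑ (permutations (x ∷ xs)) f                                   ≡⟨ ∑-concatMap (insertEverywhere x) (permutations xs) f ⟩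
  ∑ (permutations xs) (λ w → ∑ (insertEverywhere x w) f)        ≡⟨ ∑-permutations-↭ p _ ⟩
  ∑ (permutations ys) (λ w → ∑ (insertEverywhere x w) f)        ≡⟨ ∑-concatMap (insertEverywhere x) (permutations ys) f ⟨
  ∑ (permutations (x ∷ ys)) f                                   ∎
  where
  open ≡-Reasoning
∑-permutations-↭ {xs = x ∷ y ∷ xs} {ys = y ∷ x ∷ ys} (swap x y p) f = begin
  ∑ (permutations (x ∷ y ∷ xs)) f
    ≡⟨ expand x y xs ⟩
  ∑ (permutations xs) (λ w → ∑ (insertEverywhere y w) (λ u → ∑ (insertEverywhere x u) f))
    ≡⟨ ∑-permutations-↭ p _ ⟩
  ∑ (permutations ys) (λ w → ∑ (insertEverywhere y w) (λ u → ∑ (insertEverywhere x u) f))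
    ≡⟨ ∑-cong (permutations ys) (λ w → ∑-insertEverywhere-comm y x w f) ⟩
  ∑ (permutations ys) (λ w → ∑ (insertEverywhere x w) (λ u → ∑ (insertEverywhere y u) f))
    ≡⟨ expand y x ys ⟨
  ∑ (permutations (y ∷ x ∷ ys)) f ∎
  where
  open ≡-Reasoning
  expand : ∀ x y xs → ∑ (permutations (x ∷ y ∷ xs)) f ≡
    ∑ (permutations xs) (λ w → ∑ (insertEverywhere y w) (λ u → ∑ (insertEverywhere x u) f))
  expand x y xs = ≡-trans (∑-concatMap (insertEverywhere x) (permutations (y ∷ xs)) f)
                          (∑-concatMap (insertEverywhere y) (permutations xs) _)
∑-permutations-↭ (trans p q)  f = ≡-trans (∑-permutations-↭ p f) (∑-permutations-↭ q f)

insertEverywhere-map : ∀ (g : A → B) x ys → insertEverywhere (g x) (map g ys) ≡ map (map g) (insertEverywhere x ys)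
insertEverywhere-map g x []       = refl
insertEverywhere-map g x (y ∷ ys) = cong ((g x ∷ g y ∷ map g ys) ∷_) (begin
  map (g y ∷_) (insertEverywhere (g x) (map g ys)) ≡⟨ cong (map (g y ∷_)) (insertEverywhere-map g x ys) ⟩
  map (g y ∷_) (map (map g) (insertEverywhere x ys)) ≡⟨ map-∘ (insertEverywhere x ys) ⟨
  map (map g ∘ (y ∷_)) (insertEverywhere x ys) ≡⟨ map-∘ (insertEverywhere x ys) ⟩
  map (map g) (map (y ∷_) (insertEverywhere x ys)) ∎)
  where
  open ≡-Reasoning

permutations-map : ∀ (g : A → B) xs → permutations (map g xs) ≡ map (map g) (permutations xs)
permutations-map g []       = refl
permutations-map g (x ∷ xs) = begin
  concatMap (insertEverywhere (g x)) (permutations (map g xs))       ≡⟨ cong (concatMap (insertEverywhere (g x))) (permutations-map g xs) ⟩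
  concatMap (insertEverywhere (g x)) (map (map g) (permutations xs)) ≡⟨ concatMap-map (insertEverywhere (g x)) (map g) (permutations xs) ⟩
  concatMap (insertEverywhere (g x) ∘ map g) (permutations xs)       ≡⟨ concatMap-cong (insertEverywhere-map g x) (permutations xs) ⟩
  concatMap (map (map g) ∘ insertEverywhere x) (permutations xs)     ≡⟨ map-concatMap (map g) (insertEverywhere x) (permutations xs) ⟨
  map (map g) (concatMap (insertEverywhere x) (permutations xs))     ∎
  where
  open ≡-Reasoning

-- The transposition of `x` and `suc x`. Recursion on both arguments lets `<ᵇ` and `≡ᵇ` compute
-- alongside it.
transposeSuc : ℕ → ℕ → ℕ
transposeSuc zero    zero          = 1
transposeSuc zero    (suc zero)    = 0
transposeSuc zero    (suc (suc y)) = suc (suc y)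
transposeSuc (suc x) zero          = zero
transposeSuc (suc x) (suc y)       = suc (transposeSuc x y)

applyUpTo-transposeSuc : ∀ (f : ℕ → A) x n → suc x < n → applyUpTo (f ∘ transposeSuc x) n ↭ applyUpTo f n
applyUpTo-transposeSuc f zero    (suc zero)    (s≤s ())
applyUpTo-transposeSuc f zero    (suc (suc n)) _         = swap (f 1) (f 0) ↭-refl
applyUpTo-transposeSuc f (suc x) (suc n)       (s≤s x<n) = prep (f 0) (applyUpTo-transposeSuc (f ∘ suc) x n x<n)

map-transposeSuc-↭ : ∀ {x n σ} → 1 ≤ x → x < n → σ ↭ ranks n → map (transposeSuc x) σ ↭ ranks n
map-transposeSuc-↭ {suc x} {n} _ x<n σ↭ = ↭-trans (map⁺ (transposeSuc (suc x)) σ↭)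
  (subst (_↭ ranks n) (sym (map-applyUpTo suc (transposeSuc (suc x)) n)) (applyUpTo-transposeSuc suc x n x<n))

-- Invariance of the uniform distribution under relabelling: `permutations` commutes with `map`, and
-- the transposition only reorders `ranks n`.
∑-arrivalOrders-transposeSuc : ∀ {x n} → 1 ≤ x → x < n → (f : List ℕ → ℚ) →
  ∑ (arrivalOrders n) (f ∘ map (transposeSuc x)) ≡ ∑ (arrivalOrders n) f
∑-arrivalOrders-transposeSuc {x} {n} 1≤x x<n f = begin
  ∑ (arrivalOrders n) (f ∘ map τ)              ≡⟨ ∑-map (map τ) (arrivalOrders n) f ⟨
  ∑ (map (map τ) (permutations (ranks n))) f   ≡⟨ cong (λ ps → ∑ ps f) (permutations-map τ (ranks n)) ⟨
  ∑ (permutations (map τ (ranks n))) f         ≡⟨ ∑-permutations-↭ (map-transposeSuc-↭ 1≤x x<n ↭-refl) f ⟩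
  ∑ (arrivalOrders n) f                        ∎
  where
  open ≡-Reasoning
  τ = transposeSuc x

-- `suc x` is the only threshold that separates `x` from `suc x`; every other one leaves both on the
-- same side.
transposeSuc-<ᵇ : ∀ x y {a} → a ≢ suc x → (transposeSuc x y <ᵇ a) ≡ (y <ᵇ a)
transposeSuc-<ᵇ zero    zero          {zero}        _   = refl
transposeSuc-<ᵇ zero    zero          {suc zero}    a≢1 = contradiction refl a≢1
transposeSuc-<ᵇ zero    zero          {suc (suc a)} _   = refl
transposeSuc-<ᵇ zero    (suc zero)    {zero}        _   = refl
transposeSuc-<ᵇ zero    (suc zero)    {suc zero}    a≢1 = contradiction refl a≢1
transposeSuc-<ᵇ zero    (suc zero)    {suc (suc a)} _   = refl
transposeSuc-<ᵇ zero    (suc (suc y)) _ = refl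
transposeSuc-<ᵇ (suc x) zero          _ = refl
transposeSuc-<ᵇ (suc x) (suc y) {zero}  _    = refl
transposeSuc-<ᵇ (suc x) (suc y) {suc a} a≢2+x = transposeSuc-<ᵇ x y (a≢2+x ∘ cong suc)

transposeSuc-≡ᵇ : ∀ x y → (transposeSuc x y ≡ᵇ suc x) ≡ (y ≡ᵇ x)
transposeSuc-≡ᵇ zero    zero          = refl
transposeSuc-≡ᵇ zero    (suc zero)    = refl
transposeSuc-≡ᵇ zero    (suc (suc y)) = refl
transposeSuc-≡ᵇ (suc x) zero          = refl
transposeSuc-≡ᵇ (suc x) (suc y)       = transposeSuc-≡ᵇ x y

-- Order statistics and the reference rank

countB-++ : ∀ (f : A → Bool) xs {ys} → countB f (xs ++ ys) ≡ countB f xs + countB f ys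
countB-++ f []       = refl
countB-++ f (x ∷ xs) with f x
... | true  = cong suc (countB-++ f xs)
... | false = countB-++ f xs

countB-↭ : ∀ (f : A → Bool) {xs ys} → xs ↭ ys → countB f xs ≡ countB f ys
countB-↭ f refl       = refl
countB-↭ f (prep x p) with f x
... | true  = cong suc (countB-↭ f p)
... | false = countB-↭ f p
countB-↭ f (swap x y p) with f x | f y
... | true  | true  = cong (suc ∘ suc) (countB-↭ f p)
... | true  | false = cong suc (countB-↭ f p)
... | false | true  = cong suc (countB-↭ f p)
... | false | false = countB-↭ f p
countB-↭ f (trans p q) = ≡-trans (countB-↭ f p) (countB-↭ f q)

countB-map : ∀ (f : B → Bool) {f′ : A → Bool} (g : A → B) → (∀ x → f (g x) ≡ f′ x) → ∀ xs →
  countB f (map g xs) ≡ countB f′ xs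
countB-map f g eq []       = refl
countB-map f {f′} g eq (x ∷ xs) rewrite eq x with f′ x
... | true  = cong suc (countB-map f g eq xs)
... | false = countB-map f g eq xs

countB-none : ∀ (f : A → Bool) {xs} → All (λ x → ¬ T (f x)) xs → countB f xs ≡ 0
countB-none f []           = refl
countB-none f {x ∷ xs} (¬fx ∷ ¬fxs) with f x
... | true  = ⊥-elim (¬fx tt)
... | false = countB-none f ¬fxs

countB-<ᵇ-ranks : ∀ a n → countB (_<ᵇ suc a) (ranks n) ≡ a ⊓ n
countB-<ᵇ-ranks a n = go a n
  where
  shift : ∀ a n (g : ℕ → ℕ) → countB (_<ᵇ suc a) (applyUpTo (suc ∘ g) n) ≡ countB (_<ᵇ a) (applyUpTo g n)
  shift a zero    g = refl
  shift a (suc n) g with g 0 <ᵇ a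
  ... | true  = cong suc (shift a n (g ∘ suc))
  ... | false = shift a n (g ∘ suc)
  go : ∀ a n → countB (_<ᵇ suc a) (applyUpTo suc n) ≡ a ⊓ n
  go zero    n       = ≡-trans (shift 0 n id) (countB-none (_<ᵇ 0) (All.universal (λ _ ()) (applyUpTo id n)))
  go (suc a) zero    = refl
  go (suc a) (suc n) = cong suc (≡-trans (shift (suc a) n suc) (go a n))

insertℕ-↭ : ∀ x ys → insertℕ x ys ↭ x ∷ ys
insertℕ-↭ x []       = ↭-refl
insertℕ-↭ x (y ∷ ys) with x ≤ᵇ y
... | true  = ↭-refl
... | false = ↭-trans (prep y (insertℕ-↭ x ys)) (swap y x ↭-refl)

sortℕ-↭ : ∀ xs → sortℕ xs ↭ xs
sortℕ-↭ []       = ↭-refl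
sortℕ-↭ (x ∷ xs) = ↭-trans (insertℕ-↭ x (sortℕ xs)) (prep x (sortℕ-↭ xs))

insertℕ-sorted : ∀ x {ys} → AllPairs _≤_ ys → AllPairs _≤_ (insertℕ x ys)
insertℕ-sorted x []          = [] ∷ []
insertℕ-sorted x {y ∷ ys} (y≤ ∷ ys↗) with x ≤ᵇ y in eq
... | true  = (x≤y ∷ All.map (≤-trans x≤y) y≤) ∷ y≤ ∷ ys↗
  where
  x≤y : x ≤ y
  x≤y = ≤ᵇ⇒≤ x y (subst T (sym eq) tt)
... | false = All-resp-↭ (↭-sym (insertℕ-↭ x ys)) (y≤x ∷ y≤) ∷ insertℕ-sorted x ys↗
  where
  y≤x : y ≤ x
  y≤x = ℕ.≰⇒≥ (λ x≤y → subst T eq (≤⇒≤ᵇ x≤y))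

sortℕ-sorted : ∀ xs → AllPairs _≤_ (sortℕ xs)
sortℕ-sorted []       = []
sortℕ-sorted (x ∷ xs) = insertℕ-sorted x (sortℕ-sorted xs)

module _ {a : ℕ} where

  countB-<ᵇ-none : ∀ {x xs} → a ≤ x → All (x ≤_) xs → countB (_<ᵇ a) xs ≡ 0
  countB-<ᵇ-none a≤x x≤ = countB-none (_<ᵇ a)
    (All.map (λ {y} x≤y y<ᵇa → ℕ.<⇒≱ (ℕ.<ᵇ⇒< y a y<ᵇa) (≤-trans a≤x x≤y)) x≤)

  -- In a sorted list the entries below `a` form a prefix. With the converse below, this trades the
  -- order statistic for counts, which are invariant under reordering and additive over sample and
  -- rest. The bound on `i` rules out the default 0 of `nthℕ`, which would lie below every positive
  -- `a`.
  nthℕ<⇒<countB : ∀ i {xs} → AllPairs _≤_ xs → i < length xs → nthℕ i xs < a → i < countB (_<ᵇ a) xs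
  nthℕ<⇒<countB zero    {x ∷ xs} _ _ x<a with x <ᵇ a | ℕ.<⇒<ᵇ x<a
  ... | true | _ = s≤s z≤n
  nthℕ<⇒<countB (suc i) {x ∷ xs} (x≤ ∷ xs↗) (s≤s i<) nth<a with nthℕ<⇒<countB i xs↗ i< nth<a | x <ᵇ a in eq
  ... | i<count | true  = s≤s i<count
  ... | i<count | false =
    contradiction (subst (i <_) (countB-<ᵇ-none (≮⇒≥ (λ x<a → subst T eq (ℕ.<⇒<ᵇ x<a))) x≤) i<count) (λ ())

  <countB⇒nthℕ< : ∀ i {xs} → AllPairs _≤_ xs → i < countB (_<ᵇ a) xs → nthℕ i xs < a
  <countB⇒nthℕ< i {x ∷ xs} (x≤ ∷ xs↗) i<count with x <ᵇ a in eq
  <countB⇒nthℕ< zero    {x ∷ xs} _ i<count | true  = ℕ.<ᵇ⇒< x a (subst T (sym eq) tt)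
  <countB⇒nthℕ< (suc i) {x ∷ xs} (_ ∷ xs↗) (s≤s i<count) | true = <countB⇒nthℕ< i xs↗ i<count
  <countB⇒nthℕ< i {x ∷ xs} (x≤ ∷ _) i<count | false =
    contradiction (subst (i <_) (countB-<ᵇ-none (≮⇒≥ (λ x<a → subst T eq (ℕ.<⇒<ᵇ x<a))) x≤) i<count) (λ ())

  nthℕ-sortℕ<⇒<countB : ∀ i ys → i < length ys → nthℕ i (sortℕ ys) < a → i < countB (_<ᵇ a) ys
  nthℕ-sortℕ<⇒<countB i ys i< nth<a = subst (i <_) (countB-↭ (_<ᵇ a) (sortℕ-↭ ys))
    (nthℕ<⇒<countB i (sortℕ-sorted ys) (subst (i <_) (sym (↭-length (sortℕ-↭ ys))) i<) nth<a)

  <countB⇒nthℕ-sortℕ< : ∀ i ys → i < countB (_<ᵇ a) ys → nthℕ i (sortℕ ys) < a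
  <countB⇒nthℕ-sortℕ< i ys i<count = <countB⇒nthℕ< i (sortℕ-sorted ys)
    (subst (i <_) (sym (countB-↭ (_<ᵇ a) (sortℕ-↭ ys))) i<count)

countB-all : ∀ (f : A → Bool) {xs} → All (T ∘ f) xs → countB f xs ≡ length xs
countB-all f []           = refl
countB-all f {x ∷ xs} (fx ∷ fxs) with f x
... | true = cong suc (countB-all f fxs)

countB-<ᵇ-mono : ∀ {a b} → a ≤ b → ∀ xs → countB (_<ᵇ a) xs ≤ countB (_<ᵇ b) xs
countB-<ᵇ-mono a≤b []       = z≤n
countB-<ᵇ-mono {a} {b} a≤b (x ∷ xs) with x <ᵇ a in x<ᵇa | x <ᵇ b in x<ᵇb
... | true  | true  = s≤s (countB-<ᵇ-mono a≤b xs)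
... | true  | false = ⊥-elim (subst T x<ᵇb (ℕ.<⇒<ᵇ (≤-trans (ℕ.<ᵇ⇒< x a (subst T (sym x<ᵇa) tt)) a≤b)))
... | false | true  = ℕ.m≤n⇒m≤1+n (countB-<ᵇ-mono a≤b xs)
... | false | false = countB-<ᵇ-mono a≤b xs

-- The list of accepted items and its positions

acceptBetter-< : ∀ b s xs → All (_< s) (acceptBetter b s xs)
acceptBetter-< zero    s xs       = []
acceptBetter-< (suc b) s []       = []
acceptBetter-< (suc b) s (x ∷ xs) with x <ᵇ s in eq
... | true  = ℕ.<ᵇ⇒< x s (subst T (sym eq) tt) ∷ acceptBetter-< b s xs
... | false = acceptBetter-< (suc b) s xs

All-acceptBetter : ∀ {P : ℕ → Set} b s {xs} → All P xs → All P (acceptBetter b s xs)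
All-acceptBetter zero    s _          = []
All-acceptBetter (suc b) s []         = []
All-acceptBetter (suc b) s {x ∷ xs} (px ∷ pxs) with x <ᵇ s
... | true  = px ∷ All-acceptBetter b s pxs
... | false = All-acceptBetter (suc b) s pxs

length-acceptBetter : ∀ b s xs → length (acceptBetter b s xs) ≡ b ⊓ countB (_<ᵇ s) xs
length-acceptBetter zero    s xs       = refl
length-acceptBetter (suc b) s []       = refl
length-acceptBetter (suc b) s (x ∷ xs) with x <ᵇ s
... | true  = cong suc (length-acceptBetter b s xs)
... | false = length-acceptBetter (suc b) s xs

acceptBetter-map : ∀ b s (g : ℕ → ℕ) → (∀ x → (g x <ᵇ s) ≡ (x <ᵇ s)) → ∀ xs →
  acceptBetter b s (map g xs) ≡ map g (acceptBetter b s xs)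
acceptBetter-map zero    s g eq xs       = refl
acceptBetter-map (suc b) s g eq []       = refl
acceptBetter-map (suc b) s g eq (x ∷ xs) rewrite eq x with x <ᵇ s
... | true  = cong (g x ∷_) (acceptBetter-map b s g eq xs)
... | false = acceptBetter-map (suc b) s g eq xs

isAt : ℕ → Maybe ℕ → Bool
isAt x nothing  = false
isAt x (just y) = y ≡ᵇ x

valueAt : (ℕ → ℚ) → Maybe ℕ → ℚ
valueAt v nothing  = 0ℚ
valueAt v (just x) = v x

isJthBest-isAt : ∀ j xs → isJthBest j xs ≡ isAt 1 (nthMaybe (j ∸ 1) xs)
isJthBest-isAt j xs with nthMaybe (j ∸ 1) xs
... | just x  = refl
... | nothing = refl

nthMaybe-map : ∀ i (g : ℕ → ℕ) xs → nthMaybe i (map g xs) ≡ Maybe.map g (nthMaybe i xs)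
nthMaybe-map i       g []       = refl
nthMaybe-map zero    g (x ∷ xs) = refl
nthMaybe-map (suc i) g (x ∷ xs) = nthMaybe-map i g xs

nthMaybe-All : ∀ {P : ℕ → Set} i {xs x} → All P xs → nthMaybe i xs ≡ just x → P x
nthMaybe-All zero    (px ∷ _)   refl = px
nthMaybe-All (suc i) (_ ∷ pxs)  eq   = nthMaybe-All i pxs eq

nthMaybe⇒< : ∀ i xs {x} → nthMaybe i xs ≡ just x → i < length xs
nthMaybe⇒< zero    (_ ∷ _)  _  = s≤s z≤n
nthMaybe⇒< (suc i) (_ ∷ xs) eq = s≤s (nthMaybe⇒< i xs eq)

<⇒nthMaybe : ∀ i xs → i < length xs → Σ ℕ λ x → nthMaybe i xs ≡ just x
<⇒nthMaybe zero    (x ∷ _)  _        = x , refl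
<⇒nthMaybe (suc i) (_ ∷ xs) (s≤s i<) = <⇒nthMaybe i xs i<

-- Unfilled positions are worth 0, so the value of a run becomes a sum over the fixed range of `k`
-- positions, which can be interchanged with the sum over runs.
∑-valueAt : ∀ (v : ℕ → ℚ) k xs → length xs ≤ k → ∑ (ranks k) (λ j → valueAt v (nthMaybe (j ∸ 1) xs)) ≡ ∑ xs v
∑-valueAt v k xs le = ≡-trans (cong sumℚ (map-applyUpTo suc _ k)) (go k xs le)
  where
  go : ∀ k xs → length xs ≤ k → sumℚ (applyUpTo (λ i → valueAt v (nthMaybe i xs)) k) ≡ ∑ xs v
  go k       []       _         =
    ≡-trans (cong sumℚ (sym (map-applyUpTo id (λ _ → 0ℚ) k))) (∑-zero (applyUpTo id k))
  go (suc k) (x ∷ xs) (s≤s le) = cong (v x ℚ.+_) (go k xs le)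

∑-isAt : ∀ {n} (v : ℕ → ℚ) mx → (∀ {x} → mx ≡ just x → 1 ≤ x × x ≤ n) →
  ∑ (ranks n) (λ x → ind (isAt x mx) ℚ.* v x) ≡ valueAt v mx
∑-isAt {n} v nothing  _  = ≡-trans (∑-cong (ranks n) (λ x → ℚ.*-zeroˡ (v x))) (∑-zero (ranks n))
∑-isAt     v (just y) in-range = ∑-ranks-≡ᵇ (proj₁ (in-range refl)) (proj₂ (in-range refl)) v

-- The joint distribution of the reference rank and the accepted items

-- Here `q` is r - 1 and `u` is t - 1, the size of the sample, so that `r ∸ 1` and `t ∸ 1` reduce.
-- The bound `q < u` says that the sample has an r-th best item.
module Counting (n k q u : ℕ) (q<u : q < u) (u≤n : u ≤ n) where

  r t : ℕ
  r = suc q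
  t = suc u

  ref : List ℕ → ℕ
  ref = referenceRank t r

  accepted : List ℕ → List ℕ
  accepted = singleRef k t r

  event : ℕ → ℕ → ℕ → List ℕ → Bool
  event m x j σ = (ref σ ≡ᵇ m) ∧ isAt x (nthMaybe (j ∸ 1) (accepted σ))

  D : ℕ → ℕ → ℕ → ℚ
  D m x j = ∑ (arrivalOrders n) (ind ∘ event m x j)

  event-≡ : ∀ {m} x j σ → ref σ ≡ m →
    event m x j σ ≡ isAt x (nthMaybe (j ∸ 1) (acceptBetter k m (drop u σ)))
  event-≡ x j σ refl with ref σ ≡ᵇ ref σ in eq
  ... | true  = refl
  ... | false = ⊥-elim (subst T eq (ℕ.≡⇒≡ᵇ (ref σ) (ref σ) refl))

  event-≢ : ∀ {m} x j σ → ref σ ≢ m → event m x j σ ≡ false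
  event-≢ {m} x j σ ref≢m with ref σ ≡ᵇ m in eq
  ... | true  = contradiction (ℕ.≡ᵇ⇒≡ (ref σ) m (subst T (sym eq) tt)) ref≢m
  ... | false = refl

  module _ {σ : List ℕ} (σ↭ : σ ↭ ranks n) where

    length-sample : length (take u σ) ≡ u
    length-sample = ≡-trans (length-take u σ)
      (ℕ.m≤n⇒m⊓n≡m (subst (u ≤_) (sym (≡-trans (↭-length σ↭) (length-applyUpTo suc n))) u≤n))

    ref<⇒<countB : ∀ {a} → ref σ < a → q < countB (_<ᵇ a) (take u σ)
    ref<⇒<countB = nthℕ-sortℕ<⇒<countB q (take u σ) (subst (q <_) (sym length-sample) q<u)

    <countB⇒ref< : ∀ {a} → q < countB (_<ᵇ a) (take u σ) → ref σ < a
    <countB⇒ref< = <countB⇒nthℕ-sortℕ< q (take u σ)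

    countB-sample+rest : ∀ {a} → a ≤ n → countB (_<ᵇ suc a) (take u σ) + countB (_<ᵇ suc a) (drop u σ) ≡ a
    countB-sample+rest {a} a≤n = begin
      countB (_<ᵇ suc a) (take u σ) + countB (_<ᵇ suc a) (drop u σ) ≡⟨ countB-++ (_<ᵇ suc a) (take u σ) ⟨
      countB (_<ᵇ suc a) (take u σ ++ drop u σ) ≡⟨ cong (countB (_<ᵇ suc a)) (take++drop≡id u σ) ⟩
      countB (_<ᵇ suc a) σ                      ≡⟨ countB-↭ (_<ᵇ suc a) σ↭ ⟩
      countB (_<ᵇ suc a) (ranks n)              ≡⟨ countB-<ᵇ-ranks a n ⟩
      a ⊓ n                                     ≡⟨ ℕ.m≤n⇒m⊓n≡m a≤n ⟩
      a                                         ∎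
      where
      open ≡-Reasoning

    σ-in-range : All (λ x → 1 ≤ x × x ≤ n) σ
    σ-in-range = All.tabulate (λ x∈σ → let x∈ = ∈-resp-↭ σ↭ x∈σ in ∈-ranks⇒1≤ x∈ , ∈-ranks⇒≤ x∈)

    drop-in-range : All (λ x → 1 ≤ x × x ≤ n) (drop u σ)
    drop-in-range = All.++⁻ʳ (take u σ) (subst (All _) (sym (take++drop≡id u σ)) σ-in-range)

    take-in-range : All (λ x → 1 ≤ x × x ≤ n) (take u σ)
    take-in-range = All.++⁻ˡ (take u σ) (subst (All _) (sym (take++drop≡id u σ)) σ-in-range)

    1≤ref : 1 ≤ ref σ
    1≤ref = ≮⇒≥ (λ ref<1 → ℕ.<⇒≱ (ref<⇒<countB ref<1)
      (subst (_≤ q) (sym (ℕ.n≤0⇒n≡0 (ℕ.m+n≤o⇒m≤o _ (ℕ.≤-reflexive (countB-sample+rest z≤n))))) z≤n))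

    ref≤n : ref σ ≤ n
    ref≤n = ℕ.≤-pred (<countB⇒ref< (subst (q <_)
      (sym (≡-trans (countB-all (_<ᵇ suc n) (All.map (λ p → ℕ.<⇒<ᵇ (s≤s (proj₂ p))) take-in-range)) length-sample)) q<u))

    -- Of the ranks up to the reference, exactly `r` are in the sample, and the others arrive later.
    -- The two inequalities come from the sample counts just above and just below the reference, so
    -- its membership in the sample never has to be extracted from `nthℕ`.
    countB-rest : r + countB (_<ᵇ ref σ) (drop u σ) ≡ ref σ
    countB-rest with ref σ in eq | 1≤ref | ref≤n
    ... | suc a | _ | a<n = ℕ.≤-antisym
      (begin
        r + rest (suc a)                        ≤⟨ ℕ.+-mono-≤ (ref<⇒<countB (ℕ.≤-reflexive (cong suc eq))) (countB-<ᵇ-mono (ℕ.n≤1+n (suc a)) (drop u σ)) ⟩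
        sample (suc (suc a)) + rest (suc (suc a)) ≡⟨ countB-sample+rest a<n ⟩
        suc a                                   ∎)
      (begin
        suc a                                   ≡⟨ cong suc (countB-sample+rest (ℕ.<⇒≤ a<n)) ⟨
        suc (sample (suc a) + rest (suc a))     ≤⟨ s≤s (ℕ.+-monoˡ-≤ (rest (suc a)) (≮⇒≥ (λ q<sample → ℕ.<-irrefl eq (<countB⇒ref< q<sample)))) ⟩
        r + rest (suc a)                        ∎)
      where
      open ℕ.≤-Reasoning
      sample rest : ℕ → ℕ
      sample b = countB (_<ᵇ b) (take u σ)
      rest   b = countB (_<ᵇ b) (drop u σ)

    accepted-in-range : ∀ j {x} → nthMaybe (j ∸ 1) (accepted σ) ≡ just x → 1 ≤ x × x ≤ n
    accepted-in-range j = nthMaybe-All (j ∸ 1) (All-acceptBetter k (ref σ) drop-in-range)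

    length-accepted≤k : length (accepted σ) ≤ k
    length-accepted≤k = subst (_≤ k) (sym (length-acceptBetter k (ref σ) (drop u σ))) (ℕ.m⊓n≤m k _)

    -- By `countB-rest` the number of accepted items is the minimum of `k` and `ref σ` - `r`. The
    -- 0-based index `i` stands for the position j = `suc i`.
    <length-accepted⇒ : ∀ {i} → i < length (accepted σ) → r + suc i ≤ ref σ
    <length-accepted⇒ {i} i< = subst (r + suc i ≤_) countB-rest
      (ℕ.+-monoʳ-≤ r (≤-trans (subst (i <_) (length-acceptBetter k (ref σ) (drop u σ)) i<) (ℕ.m⊓n≤n k _)))

    ⇒<length-accepted : ∀ {i} → i < k → r + suc i ≤ ref σ → i < length (accepted σ)
    ⇒<length-accepted {i} i<k le = subst (i <_) (sym (length-acceptBetter k (ref σ) (drop u σ)))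
      (ℕ.⊓-glb i<k (ℕ.+-cancelˡ-≤ r _ _ (subst (r + suc i ≤_) (sym countB-rest) le)))

    ∑-event : ∀ m j (v : ℕ → ℚ) →
      ∑ (ranks n) (λ x → ind (event m x j σ) ℚ.* v x) ≡ ind (ref σ ≡ᵇ m) ℚ.* valueAt v (nthMaybe (j ∸ 1) (accepted σ))
    ∑-event m j v = begin
      ∑ (ranks n) (λ x → ind (event m x j σ) ℚ.* v x)
        ≡⟨ ∑-cong (ranks n) (λ x → ≡-trans (cong (ℚ._* v x) (ind-∧ (ref σ ≡ᵇ m) _)) (ℚ.*-assoc (ind (ref σ ≡ᵇ m)) _ (v x))) ⟩
      ∑ (ranks n) (λ x → ind (ref σ ≡ᵇ m) ℚ.* (ind (isAt x (nthMaybe (j ∸ 1) (accepted σ))) ℚ.* v x))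
        ≡⟨ ∑-distribˡ-* (ranks n) (ind (ref σ ≡ᵇ m)) _ ⟨
      ind (ref σ ≡ᵇ m) ℚ.* ∑ (ranks n) (λ x → ind (isAt x (nthMaybe (j ∸ 1) (accepted σ))) ℚ.* v x)
        ≡⟨ cong (ind (ref σ ≡ᵇ m) ℚ.*_) (∑-isAt v _ (accepted-in-range j)) ⟩
      ind (ref σ ≡ᵇ m) ℚ.* valueAt v (nthMaybe (j ∸ 1) (accepted σ)) ∎
      where
      open ≡-Reasoning

    event⇒ : ∀ m x j → 1 ≤ j → T (event m x j σ) → x < m × r + j ≤ m
    event⇒ m x (suc i) _ e with ref σ ≟ m
    ... | no  ref≢m = ⊥-elim (subst T (event-≢ x (suc i) σ ref≢m) e)
    ... | yes refl with nthMaybe i (accepted σ) in eq | subst T (event-≡ x (suc i) σ refl) e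
    ...   | just y | y≡ᵇx = subst (_< ref σ) (ℕ.≡ᵇ⇒≡ y x y≡ᵇx) (nthMaybe-All i (acceptBetter-< k (ref σ) (drop u σ)) eq)
                          , <length-accepted⇒ (nthMaybe⇒< i (accepted σ) eq)

  -- Two counts of the sample decide whether the reference is `m`: more than `q` items below
  -- `suc m`, and at most `q` below `m`. This way sorting never has to be compared with the exchange
  -- of labels.
  ref-cong : ∀ {σ σ′} → σ ↭ ranks n → σ′ ↭ ranks n → ∀ {m} →
    countB (_<ᵇ m) (take u σ′) ≡ countB (_<ᵇ m) (take u σ) →
    countB (_<ᵇ suc m) (take u σ′) ≡ countB (_<ᵇ suc m) (take u σ) →
    ref σ ≡ m → ref σ′ ≡ m
  ref-cong {σ} {σ′} σ↭ σ′↭ {m} eq eq⁺ refl = ℕ.≤-antisym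
    (ℕ.≤-pred (<countB⇒ref< σ′↭ (subst (q <_) (sym eq⁺) (ref<⇒<countB σ↭ ≤-refl))))
    (≮⇒≥ (λ ref′<m → ℕ.<-irrefl refl (<countB⇒ref< σ↭ (subst (q <_) eq (ref<⇒<countB σ′↭ ref′<m)))))

  -- Neither `m` nor `suc m` separates `x` from `suc x`. So the reference stays `m`, the same
  -- arrival positions are accepted, and only the two labels are exchanged.
  event-transposeSuc : ∀ {x m} j {σ} → suc x < m → σ ↭ ranks n → map (transposeSuc x) σ ↭ ranks n →
    event m (suc x) j (map (transposeSuc x) σ) ≡ event m x j σ
  event-transposeSuc {x} {m} j {σ} x<m σ↭ σ′↭ = lemma
    where
    open ≡-Reasoning
    τ = transposeSuc x
    count-eq : ∀ {a} → suc x < a → countB (_<ᵇ a) (take u (map τ σ)) ≡ countB (_<ᵇ a) (take u σ)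
    count-eq {a} x<a = ≡-trans (cong (countB (_<ᵇ a)) (take-map u σ))
      (countB-map (_<ᵇ a) τ (λ y → transposeSuc-<ᵇ x y (ℕ.<⇒≢ x<a ∘ sym)) (take u σ))
    isAt-map : ∀ mx → isAt (suc x) (Maybe.map τ mx) ≡ isAt x mx
    isAt-map nothing  = refl
    isAt-map (just y) = transposeSuc-≡ᵇ x y
    m< : suc x < suc m
    m< = ℕ.m≤n⇒m≤1+n x<m
    lemma : event m (suc x) j (map τ σ) ≡ event m x j σ
    lemma with ref σ ≟ m
    ... | no  ref≢m = ≡-trans
      (event-≢ (suc x) j (map τ σ) (ref≢m ∘ ref-cong σ′↭ σ↭ (sym (count-eq x<m)) (sym (count-eq m<))))
      (sym (event-≢ x j σ ref≢m))
    ... | yes ref≡m = begin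
      event m (suc x) j (map τ σ)
        ≡⟨ event-≡ (suc x) j (map τ σ) (ref-cong σ↭ σ′↭ (count-eq x<m) (count-eq m<) ref≡m) ⟩
      isAt (suc x) (nthMaybe (j ∸ 1) (acceptBetter k m (drop u (map τ σ))))
        ≡⟨ cong (λ xs → isAt (suc x) (nthMaybe (j ∸ 1) xs))
             (≡-trans (cong (acceptBetter k m) (drop-map u σ))
                      (acceptBetter-map k m τ (λ y → transposeSuc-<ᵇ x y (ℕ.<⇒≢ x<m ∘ sym)) (drop u σ))) ⟩
      isAt (suc x) (nthMaybe (j ∸ 1) (map τ (acceptBetter k m (drop u σ))))
        ≡⟨ cong (isAt (suc x)) (nthMaybe-map (j ∸ 1) τ (acceptBetter k m (drop u σ))) ⟩
      isAt (suc x) (Maybe.map τ (nthMaybe (j ∸ 1) (acceptBetter k m (drop u σ))))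
        ≡⟨ isAt-map (nthMaybe (j ∸ 1) (acceptBetter k m (drop u σ))) ⟩
      isAt x (nthMaybe (j ∸ 1) (acceptBetter k m (drop u σ)))
        ≡⟨ event-≡ x j σ ref≡m ⟨
      event m x j σ ∎

  -- Item 1 at position 1 can serve as the representative: if `x < m` and `r + j ≤ m` hold for some
  -- positive `x` and `j`, they hold for 1 and 1.
  weight : ℕ → ℚ
  weight m = D m 1 1

  -- The two bounds on `j` ensure that with reference `m` some item is accepted at position `j`, and
  -- only one item can be. The right-hand side does not mention `j`, which is the source of the
  -- independence from the position.
  ∑-D : ∀ {m} j → 1 ≤ j → j ≤ k → r + j ≤ m → ∑ (ranks n) (λ x → D m x j) ≡ ∑ (arrivalOrders n) (λ σ → ind (ref σ ≡ᵇ m))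
  ∑-D {m} (suc i) _ i<k le = begin
    ∑ (ranks n) (λ x → D m x (suc i))
      ≡⟨ ∑-swap (ranks n) (arrivalOrders n) (λ x → ind ∘ event m x (suc i)) ⟩
    ∑ (arrivalOrders n) (λ σ → ∑ (ranks n) (λ x → ind (event m x (suc i) σ)))
      ≡⟨ ∑-cong-∈ (arrivalOrders n) (λ σ∈ → exactly-one (∈-permutations⇒↭ (ranks n) σ∈)) ⟩
    ∑ (arrivalOrders n) (λ σ → ind (ref σ ≡ᵇ m)) ∎
    where
    open ≡-Reasoning
    present : ∀ {σ} → σ ↭ ranks n → ind (ref σ ≡ᵇ m) ℚ.* valueAt (λ _ → 1ℚ) (nthMaybe i (accepted σ)) ≡ ind (ref σ ≡ᵇ m)
    present {σ} σ↭ with ref σ ≡ᵇ m in eq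
    ... | false = ℚ.*-zeroˡ (valueAt (λ _ → 1ℚ) (nthMaybe i (accepted σ)))
    ... | true
      with <⇒nthMaybe i (accepted σ) (⇒<length-accepted σ↭ i<k (subst (r + suc i ≤_) (sym (ℕ.≡ᵇ⇒≡ (ref σ) m (subst T (sym eq) tt))) le))
    ...   | x , nth≡ = ≡-trans (ℚ.*-identityˡ _) (cong (valueAt (λ _ → 1ℚ)) nth≡)
    exactly-one : ∀ {σ} → σ ↭ ranks n → ∑ (ranks n) (λ x → ind (event m x (suc i) σ)) ≡ ind (ref σ ≡ᵇ m)
    exactly-one {σ} σ↭ = begin
      ∑ (ranks n) (λ x → ind (event m x (suc i) σ))          ≡⟨ ∑-cong (ranks n) (λ x → ℚ.*-identityʳ _) ⟨
      ∑ (ranks n) (λ x → ind (event m x (suc i) σ) ℚ.* 1ℚ)   ≡⟨ ∑-event σ↭ m (suc i) (λ _ → 1ℚ) ⟩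
      ind (ref σ ≡ᵇ m) ℚ.* valueAt (λ _ → 1ℚ) (nthMaybe i (accepted σ)) ≡⟨ present σ↭ ⟩
      ind (ref σ ≡ᵇ m)                                       ∎

  D-transposeSuc : ∀ {m x} j → 1 ≤ x → suc x < m → m ≤ n → D m (suc x) j ≡ D m x j
  D-transposeSuc {m} {x} j 1≤x x<m m≤n = begin
    ∑ (arrivalOrders n) (ind ∘ event m (suc x) j)
      ≡⟨ ∑-arrivalOrders-transposeSuc 1≤x x<n (ind ∘ event m (suc x) j) ⟨
    ∑ (arrivalOrders n) (ind ∘ event m (suc x) j ∘ map (transposeSuc x))
      ≡⟨ ∑-cong-∈ (arrivalOrders n) (λ σ∈ → let σ↭ = ∈-permutations⇒↭ (ranks n) σ∈ in
           cong ind (event-transposeSuc j x<m σ↭ (map-transposeSuc-↭ 1≤x x<n σ↭))) ⟩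
    ∑ (arrivalOrders n) (ind ∘ event m x j) ∎
    where
    open ≡-Reasoning
    x<n : x < n
    x<n = ≤-trans (ℕ.<⇒≤ x<m) m≤n

  D-const : ∀ {m} x j → 1 ≤ x → x < m → m ≤ n → D m x j ≡ D m 1 j
  D-const (suc zero)    j _ _   _   = refl
  D-const (suc (suc x)) j _ x<m m≤n =
    ≡-trans (D-transposeSuc j (s≤s z≤n) x<m m≤n) (D-const (suc x) j (s≤s z≤n) (ℕ.<⇒≤ x<m) m≤n)

  D-zero : ∀ {m} x j → 1 ≤ j → ¬ (x < m × r + j ≤ m) → D m x j ≡ 0ℚ
  D-zero {m} x j 1≤j ¬p = ≡-trans
    (∑-cong-∈ (arrivalOrders n) (λ σ∈ → ind-¬T (¬p ∘ event⇒ (∈-permutations⇒↭ (ranks n) σ∈) m x j 1≤j)))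
    (∑-zero (arrivalOrders n))

  ∑-D-product : ∀ {m} j → 1 ≤ j → m ≤ n → ∑ (ranks n) (λ x → D m x j) ≡ ∑ (ranks n) (λ x → ind (x <ᵇ m)) ℚ.* D m 1 j
  ∑-D-product {m} j 1≤j m≤n = ≡-trans (∑-cong-∈ (ranks n) (λ {x} x∈ → pointwise x (∈-ranks⇒1≤ x∈)))
                                  (sym (∑-distribʳ-* (ranks n) (λ x → ind (x <ᵇ m)) (D m 1 j)))
    where
    pointwise : ∀ x → 1 ≤ x → D m x j ≡ ind (x <ᵇ m) ℚ.* D m 1 j
    pointwise x 1≤x with x <? m
    ... | yes x<m = ≡-trans (D-const x j 1≤x x<m m≤n)
                      (sym (≡-trans (cong (ℚ._* D m 1 j) (ind-T (ℕ.<⇒<ᵇ x<m))) (ℚ.*-identityˡ (D m 1 j))))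
    ... | no  x≮m = ≡-trans (D-zero x j 1≤j (x≮m ∘ proj₁))
                      (sym (≡-trans (cong (ℚ._* D m 1 j) (ind-¬T (x≮m ∘ ℕ.<ᵇ⇒< x m))) (ℚ.*-zeroˡ (D m 1 j))))

  -- Both sides, multiplied by the number `c` of ranks below `m`, equal the number of arrival orders
  -- with reference `m`. Since r + j ≥ 2, at least one rank lies below `m`, and `c` can be
  -- cancelled.
  D-position : ∀ {m} j → 1 ≤ j → j ≤ k → r + j ≤ m → m ≤ n → D m 1 j ≡ weight m
  D-position {m} j 1≤j j≤k le m≤n = ℚ.≤-antisym (cancel (ℚ.≤-reflexive eq)) (cancel (ℚ.≤-reflexive (sym eq)))
    where
    open ≡-Reasoning
    c : ℚ
    c = ∑ (ranks n) (λ x → ind (x <ᵇ m))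
    1<m : 2 ≤ m
    1<m = ≤-trans (ℕ.+-mono-≤ (s≤s (z≤n {q})) 1≤j) le
    0<c : 0ℚ ℚ.< c
    0<c = subst (0ℚ ℚ.<_) (sym (∑-ranks-shift≤ 1 m n))
      (0<fromℕℚ (ℕ.⊓-glb (≤-trans (ℕ.<⇒≤ 1<m) m≤n) (ℕ.m+n≤o⇒m≤o∸n 1 1<m)))
    cancel : ∀ {a b} → c ℚ.* a ℚ.≤ c ℚ.* b → a ℚ.≤ b
    cancel = ℚ.*-cancelˡ-≤-pos c ⦃ ℚ.positive 0<c ⦄
    eq : c ℚ.* D m 1 j ≡ c ℚ.* D m 1 1
    eq = begin
      c ℚ.* D m 1 j                                 ≡⟨ ∑-D-product j 1≤j m≤n ⟨
      ∑ (ranks n) (λ x → D m x j)                   ≡⟨ ∑-D j 1≤j j≤k le ⟩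
      ∑ (arrivalOrders n) (λ σ → ind (ref σ ≡ᵇ m))  ≡⟨ ∑-D 1 ≤-refl (≤-trans 1≤j j≤k) (≤-trans (ℕ.+-monoʳ-≤ r 1≤j) le) ⟨
      ∑ (ranks n) (λ x → D m x 1)                   ≡⟨ ∑-D-product 1 ≤-refl m≤n ⟩
      c ℚ.* D m 1 1                                 ∎

  -- The factored form of the joint distribution; it lets the sums over items and over positions
  -- separate for each `m`.
  D-weight : ∀ {m} x j → 1 ≤ x → 1 ≤ j → j ≤ k → m ≤ n → D m x j ≡ ind (x <ᵇ m) ℚ.* (ind (r + j ≤ᵇ m) ℚ.* weight m)
  D-weight {m} x j 1≤x 1≤j j≤k m≤n with x <? m | r + j ≤? m
  ... | yes x<m | yes le  = begin
    D m x j                       ≡⟨ D-const x j 1≤x x<m m≤n ⟩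
    D m 1 j                       ≡⟨ D-position j 1≤j j≤k le m≤n ⟩
    weight m                      ≡⟨ solve 1 (λ w → w := con 1ℚ :* (con 1ℚ :* w)) refl (weight m) ⟩
    1ℚ ℚ.* (1ℚ ℚ.* weight m)      ≡⟨ cong₂ (λ a b → a ℚ.* (b ℚ.* weight m)) (ind-T (ℕ.<⇒<ᵇ x<m)) (ind-T (≤⇒≤ᵇ le)) ⟨
    ind (x <ᵇ m) ℚ.* (ind (r + j ≤ᵇ m) ℚ.* weight m) ∎
    where
    open ≡-Reasoning
    open +-*-Solver
  ... | no x≮m | _ = ≡-trans (D-zero x j 1≤j (x≮m ∘ proj₁))
    (sym (≡-trans (cong (ℚ._* (ind (r + j ≤ᵇ m) ℚ.* weight m)) (ind-¬T (x≮m ∘ ℕ.<ᵇ⇒< x m))) (ℚ.*-zeroˡ (ind (r + j ≤ᵇ m) ℚ.* weight m))))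
  ... | yes _ | no ¬le = ≡-trans (D-zero x j 1≤j (¬le ∘ proj₂))
    (sym (≡-trans (cong (λ a → ind (x <ᵇ m) ℚ.* (a ℚ.* weight m)) (ind-¬T (¬le ∘ ≤ᵇ⇒≤ (r + j) m)))
           (solve 2 (λ a w → a :* (con 0ℚ :* w) := con 0ℚ) refl (ind (x <ᵇ m)) (weight m))))
    where
    open +-*-Solver

  0≤weight : ∀ m → 0ℚ ℚ.≤ weight m
  0≤weight m = ∑-nonneg (arrivalOrders n) (λ _ → 0≤ind _)

  positions : ℕ → ℚ
  positions m = ∑ (ranks k) (λ j → ind (r + j ≤ᵇ m))

  0≤positions : ∀ m → 0ℚ ℚ.≤ positions m
  0≤positions m = ∑-nonneg (ranks k) (λ _ → 0≤ind _)

  ∑-ref : ∀ {σ} → σ ↭ ranks n → (c : ℚ) → ∑ (ranks n) (λ m → ind (ref σ ≡ᵇ m) ℚ.* c) ≡ c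
  ∑-ref σ↭ c = ∑-ranks-≡ᵇ (1≤ref σ↭) (ref≤n σ↭) (λ _ → c)

  ∑-accepted : ∀ (v : ℕ → ℚ) → ∑ (arrivalOrders n) (λ σ → ∑ (accepted σ) v) ≡
    ∑ (ranks n) (λ m → (positions m ℚ.* weight m) ℚ.* ∑ (ranks n) (λ x → ind (x <ᵇ m) ℚ.* v x))
  ∑-accepted v = begin
    ∑ S (λ σ → ∑ (accepted σ) v)
      ≡⟨ ∑-cong-∈ S (λ σ∈ → split (∈-permutations⇒↭ (ranks n) σ∈)) ⟩
    ∑ S (λ σ → ∑ (ranks n) (λ m → ∑ (ranks k) (λ j → ∑ (ranks n) (λ x → ind (event m x j σ) ℚ.* v x))))
      ≡⟨ ∑-swap S (ranks n) _ ⟩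
    ∑ (ranks n) (λ m → ∑ S (λ σ → ∑ (ranks k) (λ j → ∑ (ranks n) (λ x → ind (event m x j σ) ℚ.* v x))))
      ≡⟨ ∑-cong-∈ (ranks n) (λ {m} m∈ → given-ref m (∈-ranks⇒≤ m∈)) ⟩
    ∑ (ranks n) (λ m → (positions m ℚ.* weight m) ℚ.* ∑ (ranks n) (λ x → ind (x <ᵇ m) ℚ.* v x)) ∎
    where
    open ≡-Reasoning
    open +-*-Solver
    S = arrivalOrders n
    split : ∀ {σ} → σ ↭ ranks n → ∑ (accepted σ) v ≡
      ∑ (ranks n) (λ m → ∑ (ranks k) (λ j → ∑ (ranks n) (λ x → ind (event m x j σ) ℚ.* v x)))
    split {σ} σ↭ = begin
      ∑ (accepted σ) v
        -- The reference is exactly one of the ranks 1 to `n`, so its indicators add up to 1 and the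
        -- run can be split by `m`.
        ≡⟨ ∑-ref σ↭ _ ⟨
      ∑ (ranks n) (λ m → ind (ref σ ≡ᵇ m) ℚ.* ∑ (accepted σ) v)
        ≡⟨ ∑-cong (ranks n) (λ m → begin
             ind (ref σ ≡ᵇ m) ℚ.* ∑ (accepted σ) v
               ≡⟨ cong (ind (ref σ ≡ᵇ m) ℚ.*_) (∑-valueAt v k (accepted σ) (length-accepted≤k σ↭)) ⟨
             ind (ref σ ≡ᵇ m) ℚ.* ∑ (ranks k) (λ j → valueAt v (nthMaybe (j ∸ 1) (accepted σ)))
               ≡⟨ ∑-distribˡ-* (ranks k) (ind (ref σ ≡ᵇ m)) _ ⟩
             ∑ (ranks k) (λ j → ind (ref σ ≡ᵇ m) ℚ.* valueAt v (nthMaybe (j ∸ 1) (accepted σ)))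
               ≡⟨ ∑-cong (ranks k) (λ j → ∑-event σ↭ m j v) ⟨
             ∑ (ranks k) (λ j → ∑ (ranks n) (λ x → ind (event m x j σ) ℚ.* v x)) ∎) ⟩
      ∑ (ranks n) (λ m → ∑ (ranks k) (λ j → ∑ (ranks n) (λ x → ind (event m x j σ) ℚ.* v x))) ∎
    given-ref : ∀ m → m ≤ n →
      ∑ S (λ σ → ∑ (ranks k) (λ j → ∑ (ranks n) (λ x → ind (event m x j σ) ℚ.* v x))) ≡
      (positions m ℚ.* weight m) ℚ.* ∑ (ranks n) (λ x → ind (x <ᵇ m) ℚ.* v x)
    given-ref m m≤n = begin
      ∑ S (λ σ → ∑ (ranks k) (λ j → ∑ (ranks n) (λ x → ind (event m x j σ) ℚ.* v x)))
        ≡⟨ ∑-swap S (ranks k) _ ⟩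
      ∑ (ranks k) (λ j → ∑ S (λ σ → ∑ (ranks n) (λ x → ind (event m x j σ) ℚ.* v x)))
        ≡⟨ ∑-cong-∈ (ranks k) (λ {j} j∈ → begin
             ∑ S (λ σ → ∑ (ranks n) (λ x → ind (event m x j σ) ℚ.* v x))
               ≡⟨ ∑-swap S (ranks n) _ ⟩
             ∑ (ranks n) (λ x → ∑ S (λ σ → ind (event m x j σ) ℚ.* v x))
               ≡⟨ ∑-cong-∈ (ranks n) (λ {x} x∈ → begin
                    ∑ S (λ σ → ind (event m x j σ) ℚ.* v x)
                      ≡⟨ ∑-distribʳ-* S (ind ∘ event m x j) (v x) ⟨
                    D m x j ℚ.* v x
                      ≡⟨ cong (ℚ._* v x) (D-weight x j (∈-ranks⇒1≤ x∈) (∈-ranks⇒1≤ j∈) (∈-ranks⇒≤ j∈) m≤n) ⟩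
                    (ind (x <ᵇ m) ℚ.* (ind (r + j ≤ᵇ m) ℚ.* weight m)) ℚ.* v x
                      ≡⟨ solve 3 (λ a b c → (a :* b) :* c := b :* (a :* c)) refl
                           (ind (x <ᵇ m)) (ind (r + j ≤ᵇ m) ℚ.* weight m) (v x) ⟩
                    (ind (r + j ≤ᵇ m) ℚ.* weight m) ℚ.* (ind (x <ᵇ m) ℚ.* v x) ∎) ⟩
             ∑ (ranks n) (λ x → (ind (r + j ≤ᵇ m) ℚ.* weight m) ℚ.* (ind (x <ᵇ m) ℚ.* v x))
               ≡⟨ ∑-distribˡ-* (ranks n) (ind (r + j ≤ᵇ m) ℚ.* weight m) _ ⟨
             (ind (r + j ≤ᵇ m) ℚ.* weight m) ℚ.* ∑ (ranks n) (λ x → ind (x <ᵇ m) ℚ.* v x) ∎) ⟩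
      ∑ (ranks k) (λ j → (ind (r + j ≤ᵇ m) ℚ.* weight m) ℚ.* ∑ (ranks n) (λ x → ind (x <ᵇ m) ℚ.* v x))
        ≡⟨ ∑-distribʳ-* (ranks k) (λ j → ind (r + j ≤ᵇ m) ℚ.* weight m) _ ⟨
      ∑ (ranks k) (λ j → ind (r + j ≤ᵇ m) ℚ.* weight m) ℚ.* ∑ (ranks n) (λ x → ind (x <ᵇ m) ℚ.* v x)
        ≡⟨ cong (ℚ._* ∑ (ranks n) (λ x → ind (x <ᵇ m) ℚ.* v x)) (∑-distribʳ-* (ranks k) (λ j → ind (r + j ≤ᵇ m)) (weight m)) ⟨
      (positions m ℚ.* weight m) ℚ.* ∑ (ranks n) (λ x → ind (x <ᵇ m) ℚ.* v x) ∎

  countB-isJthBest : ∀ j → 1 ≤ j → j ≤ k →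
    fromℕℚ (countB (λ σ → isJthBest j (accepted σ)) (arrivalOrders n)) ≡ ∑ (ranks n) (λ m → ind (r + j ≤ᵇ m) ℚ.* weight m)
  countB-isJthBest j 1≤j j≤k = begin
    fromℕℚ (countB (λ σ → isJthBest j (accepted σ)) S)
      ≡⟨ countB-∑ _ S ⟩
    ∑ S (λ σ → ind (isJthBest j (accepted σ)))
      ≡⟨ ∑-cong-∈ S (λ σ∈ → split (∈-permutations⇒↭ (ranks n) σ∈)) ⟩
    ∑ S (λ σ → ∑ (ranks n) (λ m → ind (event m 1 j σ)))
      ≡⟨ ∑-swap S (ranks n) _ ⟩
    ∑ (ranks n) (λ m → D m 1 j)
      ≡⟨ ∑-cong-∈ (ranks n) (λ {m} m∈ → ≡-trans (D-weight 1 j ≤-refl 1≤j j≤k (∈-ranks⇒≤ m∈)) (absorb m)) ⟩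
    ∑ (ranks n) (λ m → ind (r + j ≤ᵇ m) ℚ.* weight m) ∎
    where
    open ≡-Reasoning
    S = arrivalOrders n
    split : ∀ {σ} → σ ↭ ranks n → ind (isJthBest j (accepted σ)) ≡ ∑ (ranks n) (λ m → ind (event m 1 j σ))
    split {σ} σ↭ = begin
      ind (isJthBest j (accepted σ))
        ≡⟨ ∑-ref σ↭ _ ⟨
      ∑ (ranks n) (λ m → ind (ref σ ≡ᵇ m) ℚ.* ind (isJthBest j (accepted σ)))
        ≡⟨ ∑-cong (ranks n) (λ m → ≡-trans
             (cong (λ b → ind (ref σ ≡ᵇ m) ℚ.* ind b) (isJthBest-isAt j (accepted σ)))
             (sym (ind-∧ (ref σ ≡ᵇ m) _))) ⟩
      ∑ (ranks n) (λ m → ind (event m 1 j σ)) ∎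
    -- Since r + j ≥ 2, the condition on `j` already makes item 1 better than the reference.
    absorb : ∀ m → ind (1 <ᵇ m) ℚ.* (ind (r + j ≤ᵇ m) ℚ.* weight m) ≡ ind (r + j ≤ᵇ m) ℚ.* weight m
    absorb m with r + j ≤? m
    ... | yes le = ≡-trans (cong (ℚ._* (ind (r + j ≤ᵇ m) ℚ.* weight m))
        (ind-T (ℕ.<⇒<ᵇ (≤-trans (ℕ.+-mono-≤ (s≤s (z≤n {q})) 1≤j) le)))) (ℚ.*-identityˡ _)
    ... | no ¬le = ≡-trans (cong (ind (1 <ᵇ m) ℚ.*_) zero-product) (≡-trans (ℚ.*-zeroʳ (ind (1 <ᵇ m))) (sym zero-product))
      where
      zero-product : ind (r + j ≤ᵇ m) ℚ.* weight m ≡ 0ℚ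
      zero-product = ≡-trans (cong (ℚ._* weight m) (ind-¬T (¬le ∘ ≤ᵇ⇒≤ (r + j) m))) (ℚ.*-zeroˡ (weight m))

-- Prefix averages and partial sums of the weights `γ`

∑-ranks-one : ∀ k → ∑ (ranks k) (λ _ → 1ℚ) ≡ fromℕℚ k
∑-ranks-one zero    = refl
∑-ranks-one (suc k) = ≡-trans (∑-ranks-suc k (λ _ → 1ℚ)) (≡-trans (cong (ℚ._+ 1ℚ) (∑-ranks-one k)) (sym (fromℕℚ-suc k)))

-- Cross-multiplied comparison of the average over the ranks below `m` with the average over all
-- `k`. Once the prefix is complete, a further rank adds `a` times the smallest value on the left
-- and `w` on the right, and each of the `a` terms of `w` is at least that value.
prefix-average : ∀ m k (v : ℕ → ℚ) → (∀ {x y} → 1 ≤ x → x ≤ y → y ≤ k → v y ℚ.≤ v x) →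
  ∑ (ranks k) (λ x → ind (x <ᵇ m)) ℚ.* ∑ (ranks k) v ℚ.≤ fromℕℚ k ℚ.* ∑ (ranks k) (λ x → ind (x <ᵇ m) ℚ.* v x)
prefix-average m zero    v antitone = ℚ.≤-refl
prefix-average m (suc k) v antitone with suc k <? m
... | yes k<m = ℚ.≤-reflexive (cong₂ ℚ._*_
  (≡-trans (∑-cong-∈ (ranks (suc k)) (λ {x} x∈ → ind-T (ℕ.<⇒<ᵇ (ℕ.≤-<-trans (∈-ranks⇒≤ x∈) k<m)))) (∑-ranks-one (suc k)))
  (∑-cong-∈ (ranks (suc k)) (λ {x} x∈ → sym (≡-trans
    (cong (ℚ._* v x) (ind-T (ℕ.<⇒<ᵇ (ℕ.≤-<-trans (∈-ranks⇒≤ x∈) k<m)))) (ℚ.*-identityˡ (v x))))))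
... | no k≮m = begin
  ∑ (ranks (suc k)) (λ x → ind (x <ᵇ m)) ℚ.* ∑ (ranks (suc k)) v
    ≡⟨ cong₂ ℚ._*_ (≡-trans (∑-ranks-suc k (λ x → ind (x <ᵇ m))) (≡-trans (cong (a ℚ.+_) last≡0) (ℚ.+-identityʳ a))) (∑-ranks-suc k v) ⟩
  a ℚ.* (∑ (ranks k) v ℚ.+ v (suc k))
    ≡⟨ ℚ.*-distribˡ-+ a _ _ ⟩
  a ℚ.* ∑ (ranks k) v ℚ.+ a ℚ.* v (suc k)
    ≤⟨ ℚ.+-mono-≤ (prefix-average m k v (λ 1≤x x≤y y≤k → antitone 1≤x x≤y (ℕ.m≤n⇒m≤1+n y≤k))) last≤ ⟩
  fromℕℚ k ℚ.* w ℚ.+ w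
    ≡⟨ solve 2 (λ k w → k :* w :+ w := (k :+ con 1ℚ) :* (w :+ con 0ℚ)) refl (fromℕℚ k) w ⟩
  (fromℕℚ k ℚ.+ 1ℚ) ℚ.* (w ℚ.+ 0ℚ)
    ≡⟨ cong₂ (λ b c → b ℚ.* (w ℚ.+ c)) (fromℕℚ-suc k) (≡-trans (cong (ℚ._* v (suc k)) last≡0) (ℚ.*-zeroˡ (v (suc k)))) ⟨
  fromℕℚ (suc k) ℚ.* (w ℚ.+ ind (suc k <ᵇ m) ℚ.* v (suc k))
    ≡⟨ cong (fromℕℚ (suc k) ℚ.*_) (∑-ranks-suc k (λ x → ind (x <ᵇ m) ℚ.* v x)) ⟨
  fromℕℚ (suc k) ℚ.* ∑ (ranks (suc k)) (λ x → ind (x <ᵇ m) ℚ.* v x) ∎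
  where
  open ℚ.≤-Reasoning
  open +-*-Solver
  a w : ℚ
  a = ∑ (ranks k) (λ x → ind (x <ᵇ m))
  w = ∑ (ranks k) (λ x → ind (x <ᵇ m) ℚ.* v x)
  last≡0 : ind (suc k <ᵇ m) ≡ 0ℚ
  last≡0 = ind-¬T (k≮m ∘ ℕ.<ᵇ⇒< (suc k) m)
  last≤ : a ℚ.* v (suc k) ℚ.≤ w
  last≤ = subst (ℚ._≤ w) (sym (∑-distribʳ-* (ranks k) (λ x → ind (x <ᵇ m)) (v (suc k))))
    (∑-mono-∈ (ranks k) (λ {x} x∈ → ℚ.*-monoˡ-≤-nonNeg (ind (x <ᵇ m)) ⦃ nonNegative (0≤ind (x <ᵇ m)) ⦄
      (antitone (∈-ranks⇒1≤ x∈) (ℕ.m≤n⇒m≤1+n (∈-ranks⇒≤ x∈)) ≤-refl)))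

¬T⇒≡false : ∀ {b} → ¬ T b → b ≡ false
¬T⇒≡false {false} _  = refl
¬T⇒≡false {true}  ¬t = ⊥-elim (¬t tt)

-- The test in `γ` at position `suc J` is equivalent to `suc J + q ≤ k`. If it holds, both minima
-- are their second arguments and the claim is a polynomial identity; if it fails, then `k ≤ J + q`
-- and both minima are `k`.
γ-step : ∀ k q J → suc q ≤ k → J * (k ⊓ (J + q)) + γ k (suc q) (suc J) ≡ suc J * (k ⊓ (suc J + q))
γ-step k q J r≤k with suc J ≤? k ∸ suc q + 1
... | yes p rewrite Equivalence.to T-≡ (≤⇒≤ᵇ p) = begin
  J * (k ⊓ (J + q)) + (suc q + 2 * J) ≡⟨ cong (λ a → J * a + (suc q + 2 * J)) (ℕ.m≥n⇒m⊓n≡n (ℕ.<⇒≤ J+q<k)) ⟩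
  J * (J + q) + (suc q + 2 * J)       ≡⟨ solve 2 (λ J q → J :* (J :+ q) :+ (con 1 :+ q :+ con 2 :* J) := (con 1 :+ J) :* (con 1 :+ J :+ q)) refl J q ⟩
  suc J * (suc J + q)                 ≡⟨ cong (suc J *_) (ℕ.m≥n⇒m⊓n≡n J+q<k) ⟨
  suc J * (k ⊓ (suc J + q))           ∎
  where
  open ≡-Reasoning
  open ℕ-Solver.+-*-Solver
  J+q<k : suc J + q ≤ k
  J+q<k = subst (_≤ k) (ℕ.+-suc J q) (ℕ.m≤o∸n⇒m+n≤o J r≤k (ℕ.≤-pred (subst (suc J ≤_) (ℕ.+-comm (k ∸ suc q) 1) p)))
... | no ¬p rewrite ¬T⇒≡false (¬p ∘ ≤ᵇ⇒≤ (suc J) (k ∸ suc q + 1)) = begin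
  J * (k ⊓ (J + q)) + k     ≡⟨ cong (λ a → J * a + k) (ℕ.m≤n⇒m⊓n≡m k≤J+q) ⟩
  J * k + k                 ≡⟨ ℕ.+-comm (J * k) k ⟩
  suc J * k                 ≡⟨ cong (suc J *_) (ℕ.m≤n⇒m⊓n≡m (ℕ.m≤n⇒m≤1+n k≤J+q)) ⟨
  suc J * (k ⊓ (suc J + q)) ∎
  where
  open ≡-Reasoning
  k≤J+q : k ≤ J + q
  k≤J+q = ℕ.≤-pred (subst (k <_) (ℕ.+-suc J q)
    (subst (_< J + suc q) (ℕ.m∸n+n≡m r≤k) (ℕ.+-monoˡ-< (suc q)
      (ℕ.≤-pred (subst (_< suc J) (ℕ.+-comm (k ∸ suc q) 1) (≰⇒> ¬p))))))

-- Telescoping by `γ-step` up to position `m ∸ suc q`, after which the indicator vanishes and the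
-- sum stays constant.
∑-γ-closed : ∀ {k q} m → suc q ≤ k → ∀ J → ∑ (ranks J) (λ j → fromℕℚ (γ k (suc q) j) ℚ.* ind (suc q + j ≤ᵇ m)) ≡
  fromℕℚ ((J ⊓ (m ∸ suc q)) * (k ⊓ ((J ⊓ (m ∸ suc q)) + q)))
∑-γ-closed m r≤k zero    = refl
∑-γ-closed {k} {q} m r≤k (suc J) = ≡-trans (∑-ranks-suc J _)
  (≡-trans (cong (ℚ._+ fromℕℚ (γ k (suc q) (suc J)) ℚ.* ind (suc q + suc J ≤ᵇ m)) (∑-γ-closed m r≤k J)) step)
  where
  open ≡-Reasoning
  c : ℕ
  c = m ∸ suc q
  g : ℕ → ℕ
  g a = a * (k ⊓ (a + q))
  step : fromℕℚ (g (J ⊓ c)) ℚ.+ fromℕℚ (γ k (suc q) (suc J)) ℚ.* ind (suc q + suc J ≤ᵇ m) ≡ fromℕℚ (g (suc J ⊓ c))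
  step with suc q + suc J ≤? m
  ... | yes p = begin
    fromℕℚ (g (J ⊓ c)) ℚ.+ fromℕℚ (γ k (suc q) (suc J)) ℚ.* ind (suc q + suc J ≤ᵇ m)
      ≡⟨ cong₂ (λ a b → fromℕℚ (g a) ℚ.+ fromℕℚ (γ k (suc q) (suc J)) ℚ.* b) (ℕ.m≤n⇒m⊓n≡m (ℕ.<⇒≤ J<c)) (ind-T (≤⇒≤ᵇ p)) ⟩
    fromℕℚ (g J) ℚ.+ fromℕℚ (γ k (suc q) (suc J)) ℚ.* 1ℚ
      ≡⟨ cong (fromℕℚ (g J) ℚ.+_) (ℚ.*-identityʳ (fromℕℚ (γ k (suc q) (suc J)))) ⟩
    fromℕℚ (g J) ℚ.+ fromℕℚ (γ k (suc q) (suc J))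
      ≡⟨ fromℕℚ-+ (g J) (γ k (suc q) (suc J)) ⟨
    fromℕℚ (g J + γ k (suc q) (suc J))
      ≡⟨ cong fromℕℚ (γ-step k q J r≤k) ⟩
    fromℕℚ (g (suc J))
      ≡⟨ cong (fromℕℚ ∘ g) (ℕ.m≤n⇒m⊓n≡m J<c) ⟨
    fromℕℚ (g (suc J ⊓ c)) ∎
    where
    J<c : suc J ≤ c
    J<c = ℕ.m+n≤o⇒m≤o∸n (suc J) (subst (_≤ m) (ℕ.+-comm (suc q) (suc J)) p)
  ... | no ¬p = begin
    fromℕℚ (g (J ⊓ c)) ℚ.+ fromℕℚ (γ k (suc q) (suc J)) ℚ.* ind (suc q + suc J ≤ᵇ m)
      ≡⟨ cong₂ (λ a b → fromℕℚ (g a) ℚ.+ fromℕℚ (γ k (suc q) (suc J)) ℚ.* b) (ℕ.m≥n⇒m⊓n≡n c≤J) (ind-¬T (¬p ∘ ≤ᵇ⇒≤ (suc q + suc J) m)) ⟩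
    fromℕℚ (g c) ℚ.+ fromℕℚ (γ k (suc q) (suc J)) ℚ.* 0ℚ
      ≡⟨ ≡-trans (cong (fromℕℚ (g c) ℚ.+_) (ℚ.*-zeroʳ (fromℕℚ (γ k (suc q) (suc J))))) (ℚ.+-identityʳ (fromℕℚ (g c))) ⟩
    fromℕℚ (g c)
      ≡⟨ cong (fromℕℚ ∘ g) (ℕ.m≥n⇒m⊓n≡n (ℕ.m≤n⇒m≤1+n c≤J)) ⟨
    fromℕℚ (g (suc J ⊓ c)) ∎
    where
    c≤J : c ≤ J
    c≤J = ℕ.m≤n+o⇒m∸n≤o m (suc q) (ℕ.≤-pred (subst (suc m ≤_) (ℕ.+-suc (suc q) J) (≰⇒> ¬p)))

∑-γ : ∀ {k q} m → suc q ≤ k → ∑ (ranks k) (λ j → fromℕℚ (γ k (suc q) j) ℚ.* ind (suc q + j ≤ᵇ m)) ≡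
  ∑ (ranks k) (λ j → ind (suc q + j ≤ᵇ m)) ℚ.* ∑ (ranks k) (λ x → ind (x <ᵇ m))
∑-γ {k} {q} m r≤k = begin
  ∑ (ranks k) (λ j → fromℕℚ (γ k (suc q) j) ℚ.* ind (suc q + j ≤ᵇ m))
    ≡⟨ ∑-γ-closed m r≤k k ⟩
  fromℕℚ (a * (k ⊓ (a + q)))
    ≡⟨ cong fromℕℚ a*-cong ⟩
  fromℕℚ (a * (k ⊓ (m ∸ 1)))
    ≡⟨ fromℕℚ-* a (k ⊓ (m ∸ 1)) ⟩
  fromℕℚ a ℚ.* fromℕℚ (k ⊓ (m ∸ 1))
    ≡⟨ cong₂ ℚ._*_ (∑-ranks-shift≤ (suc q) m k) (∑-ranks-shift≤ 1 m k) ⟨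
  ∑ (ranks k) (λ j → ind (suc q + j ≤ᵇ m)) ℚ.* ∑ (ranks k) (λ x → ind (x <ᵇ m)) ∎
  where
  open ≡-Reasoning
  a : ℕ
  a = k ⊓ (m ∸ suc q)
  -- The factor `a` has to stay: for `m` below `r` the two minima may differ, but then `a` is 0.
  -- Otherwise either `a` is `k` and both minima are `k`, or `a + q` is `m ∸ 1`.
  a*-cong : a * (k ⊓ (a + q)) ≡ a * (k ⊓ (m ∸ 1))
  a*-cong with k ≤? m ∸ suc q | suc q ≤? m
  ... | yes p | _ rewrite ℕ.m≤n⇒m⊓n≡m p =
    cong (k *_) (≡-trans (ℕ.m≤n⇒m⊓n≡m (ℕ.m≤m+n k q)) (sym (ℕ.m≤n⇒m⊓n≡m (≤-trans p (ℕ.∸-monoʳ-≤ m (s≤s (z≤n {q})))))))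
  ... | no ¬p | yes (s≤s {n = m′} q≤m′) rewrite ℕ.m≥n⇒m⊓n≡n (ℕ.≰⇒≥ ¬p) = cong (λ b → (m′ ∸ q) * (k ⊓ b)) (ℕ.m∸n+n≡m q≤m′)
  ... | no ¬p | no r≰m rewrite ℕ.m≤n⇒m∸n≡0 (ℕ.<⇒≤ (≰⇒> r≰m)) | ℕ.⊓-zeroʳ k = refl

-- Instances close to the extremal one

antitone : ∀ {n} (V : Values n) {x y} → 1 ≤ x → x ≤ y → y ≤ n → v V y ℚ.≤ v V x
antitone V {x} {y} 1≤x x≤y y≤n with ℕ.m≤n⇒m<n∨m≡n x≤y
... | inj₂ refl = ℚ.≤-refl
antitone V {x} {suc y} 1≤x _ y<n | inj₁ (s≤s x≤y) =
  ℚ.≤-trans (ℚ.<⇒≤ (decreasing V y (≤-trans 1≤x x≤y) y<n)) (antitone V 1≤x x≤y (ℕ.<⇒≤ y<n))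

-- The indicator of the top `k` ranks is the extremal profile. The added slope in steps of δ, still
-- equal to δ at rank `n`, makes it strictly decreasing and positive.
nearlyFlat : (n k : ℕ) (δ : ℚ) → 0ℚ ℚ.< δ → Values n
nearlyFlat n k δ 0<δ = record
  { v          = λ x → ind (x ≤ᵇ k) ℚ.+ δ ℚ.* fromℕℚ (suc n ∸ x)
  ; decreasing = λ i _ i<n → ℚ.+-mono-≤-< (ind-antitone i)
      (ℚ.*-monoʳ-<-pos δ ⦃ ℚ.positive 0<δ ⦄
        (subst (λ a → fromℕℚ (n ∸ i) ℚ.< fromℕℚ a) (sym (ℕ.+-∸-assoc 1 (ℕ.<⇒≤ i<n)))
          (subst (fromℕℚ (n ∸ i) ℚ.<_) (sym (fromℕℚ-suc (n ∸ i)))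
            (subst (ℚ._< fromℕℚ (n ∸ i) ℚ.+ 1ℚ) (ℚ.+-identityʳ _) (ℚ.+-monoʳ-< (fromℕℚ (n ∸ i)) (ℚ.positive⁻¹ 1ℚ))))))
  ; positive   = λ i _ i≤n → ℚ.+-mono-≤-< (0≤ind (i ≤ᵇ k)) (0<* 0<δ (0<fromℕℚ (ℕ.m+n≤o⇒m≤o∸n 1 (s≤s i≤n))))
  }
  where
  ind-antitone : ∀ i → ind (suc i ≤ᵇ k) ℚ.≤ ind (i ≤ᵇ k)
  ind-antitone i with suc i ≤? k
  ... | yes i<k = ℚ.≤-reflexive (≡-trans (ind-T (≤⇒≤ᵇ i<k)) (sym (ind-T (≤⇒≤ᵇ (ℕ.<⇒≤ i<k)))))
  ... | no  i≮k = subst (ℚ._≤ ind (i ≤ᵇ k)) (sym (ind-¬T (i≮k ∘ ≤ᵇ⇒≤ (suc i) k))) (0≤ind (i ≤ᵇ k))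

-- The competitive ratio: lower bound and tightness

module Ratio (n k q u : ℕ) (r≤k : suc q ≤ k) (q<u : q < u) (u≤n : u ≤ n) (k≤n : k ≤ n) where
  open Counting n k q u q<u u≤n

  1≤k : 1 ≤ k
  1≤k = ≤-trans (s≤s z≤n) r≤k

  K N : ℚ
  K = fromℕℚ k
  N = fromℕℚ (n !)

  0<K : 0ℚ ℚ.< K
  0<K = 0<fromℕℚ 1≤k

  0<N : 0ℚ ℚ.< N
  0<N = 0<fromℕℚ (ℕ.1≤n! n)

  ρ : ℚ
  ρ = formula n k t r

  topBetter : ℕ → ℚ
  topBetter m = ∑ (ranks k) (λ x → ind (x <ᵇ m))

  0≤topBetter : ∀ m → 0ℚ ℚ.≤ topBetter m
  0≤topBetter m = ∑-nonneg (ranks k) (λ {x} _ → 0≤ind (x <ᵇ m))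

  coeff : ℕ → ℚ
  coeff m = positions m ℚ.* weight m

  0≤coeff : ∀ m → 0ℚ ℚ.≤ coeff m
  0≤coeff m = 0≤* (0≤positions m) (0≤weight m)

  score : ℚ
  score = ∑ (ranks n) (λ m → coeff m ℚ.* topBetter m)

  total : Values n → ℚ
  total V = ∑ (arrivalOrders n) (λ σ → ∑ (accepted σ) (v V))

  -- After the sums over `j` and `m` are interchanged, `∑-γ` evaluates the inner sum for each
  -- reference rank. So `score` is the claimed ratio cleared of its denominators, in a form
  -- comparable with `∑-accepted` term by term in `m`.
  formula-score : ρ ℚ.* (K ℚ.* N) ≡ score
  formula-score = begin
    ρ ℚ.* (K ℚ.* N)
      ≡⟨ ℚ.*-assoc ρ K N ⟨
    ρ ℚ.* K ℚ.* N
      ≡⟨ cong (ℚ._* N) (÷'-* (∑ (ranks k) (λ j → g j ℚ.* p₁ n k t r j)) 0<K) ⟩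
    ∑ (ranks k) (λ j → g j ℚ.* p₁ n k t r j) ℚ.* N
      ≡⟨ ∑-distribʳ-* (ranks k) (λ j → g j ℚ.* p₁ n k t r j) N ⟩
    ∑ (ranks k) (λ j → g j ℚ.* p₁ n k t r j ℚ.* N)
      ≡⟨ ∑-cong-∈ (ranks k) (λ {j} j∈ → begin
           g j ℚ.* p₁ n k t r j ℚ.* N
             ≡⟨ ℚ.*-assoc (g j) (p₁ n k t r j) N ⟩
           g j ℚ.* (p₁ n k t r j ℚ.* N)
             ≡⟨ cong (g j ℚ.*_) (÷'-* _ 0<N) ⟩
           g j ℚ.* fromℕℚ (countB (λ σ → isJthBest j (accepted σ)) (arrivalOrders n))
             ≡⟨ cong (g j ℚ.*_) (countB-isJthBest j (∈-ranks⇒1≤ j∈) (∈-ranks⇒≤ j∈)) ⟩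
           g j ℚ.* ∑ (ranks n) (λ m → ind (r + j ≤ᵇ m) ℚ.* weight m)
             ≡⟨ ∑-distribˡ-* (ranks n) (g j) (λ m → ind (r + j ≤ᵇ m) ℚ.* weight m) ⟩
           ∑ (ranks n) (λ m → g j ℚ.* (ind (r + j ≤ᵇ m) ℚ.* weight m)) ∎) ⟩
    ∑ (ranks k) (λ j → ∑ (ranks n) (λ m → g j ℚ.* (ind (r + j ≤ᵇ m) ℚ.* weight m)))
      ≡⟨ ∑-swap (ranks k) (ranks n) _ ⟩
    ∑ (ranks n) (λ m → ∑ (ranks k) (λ j → g j ℚ.* (ind (r + j ≤ᵇ m) ℚ.* weight m)))
      ≡⟨ ∑-cong (ranks n) (λ m → begin
           ∑ (ranks k) (λ j → g j ℚ.* (ind (r + j ≤ᵇ m) ℚ.* weight m))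
             ≡⟨ ∑-cong (ranks k) (λ j → ℚ.*-assoc (g j) (ind (r + j ≤ᵇ m)) (weight m)) ⟨
           ∑ (ranks k) (λ j → g j ℚ.* ind (r + j ≤ᵇ m) ℚ.* weight m)
             ≡⟨ ∑-distribʳ-* (ranks k) (λ j → g j ℚ.* ind (r + j ≤ᵇ m)) (weight m) ⟨
           ∑ (ranks k) (λ j → g j ℚ.* ind (r + j ≤ᵇ m)) ℚ.* weight m
             ≡⟨ cong (ℚ._* weight m) (∑-γ m r≤k) ⟩
           positions m ℚ.* topBetter m ℚ.* weight m
             ≡⟨ solve 3 (λ a b c → a :* b :* c := a :* c :* b) refl (positions m) (topBetter m) (weight m) ⟩
           coeff m ℚ.* topBetter m ∎) ⟩
    score ∎
    where
    open ≡-Reasoning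
    open +-*-Solver
    g : ℕ → ℚ
    g j = fromℕℚ (γ k r j)

  module _ (V : Values n) where

    O : ℚ
    O = OPT n k V

    0<OPT : 0ℚ ℚ.< O
    0<OPT = ℚ.<-≤-trans (positive V 1 ≤-refl (≤-trans 1≤k k≤n))
      (subst (ℚ._≤ O) (ℚ.+-identityʳ (v V 1))
        (∑-ranks-mono 1≤k (λ x∈ → ℚ.<⇒≤ (positive V _ (∈-ranks⇒1≤ x∈) (≤-trans (∈-ranks⇒≤ x∈) k≤n)))))

    ratio-total : ratio n k accepted V ℚ.* (O ℚ.* N) ≡ total V
    ratio-total = begin
      ratio n k accepted V ℚ.* (O ℚ.* N)   ≡⟨ ℚ.*-assoc (ratio n k accepted V) O N ⟨
      ratio n k accepted V ℚ.* O ℚ.* N     ≡⟨ cong (ℚ._* N) (÷'-* (expectedALG n accepted V) 0<OPT) ⟩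
      expectedALG n accepted V ℚ.* N       ≡⟨ ÷'-* (total V) 0<N ⟩
      total V                              ∎
      where
      open ≡-Reasoning

    score-OPT≤ : score ℚ.* O ℚ.≤ total V ℚ.* K
    score-OPT≤ = begin
      score ℚ.* O
        ≡⟨ ∑-distribʳ-* (ranks n) (λ m → coeff m ℚ.* topBetter m) O ⟩
      ∑ (ranks n) (λ m → coeff m ℚ.* topBetter m ℚ.* O)
        ≤⟨ ∑-mono-∈ (ranks n) (λ {m} _ → begin
             coeff m ℚ.* topBetter m ℚ.* O     ≡⟨ ℚ.*-assoc (coeff m) (topBetter m) O ⟩
             coeff m ℚ.* (topBetter m ℚ.* O)   ≤⟨ ℚ.*-monoˡ-≤-nonNeg (coeff m) ⦃ nonNegative (0≤coeff m) ⦄ (average m) ⟩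
             coeff m ℚ.* (K ℚ.* better m)      ≡⟨ solve 3 (λ a b c → a :* (b :* c) := a :* c :* b) refl (coeff m) K (better m) ⟩
             coeff m ℚ.* better m ℚ.* K        ∎) ⟩
      ∑ (ranks n) (λ m → coeff m ℚ.* better m ℚ.* K)
        ≡⟨ ∑-distribʳ-* (ranks n) (λ m → coeff m ℚ.* better m) K ⟨
      ∑ (ranks n) (λ m → coeff m ℚ.* better m) ℚ.* K
        ≡⟨ cong (ℚ._* K) (∑-accepted (v V)) ⟨
      total V ℚ.* K ∎
      where
      open ℚ.≤-Reasoning
      open +-*-Solver
      better : ℕ → ℚ
      better m = ∑ (ranks n) (λ x → ind (x <ᵇ m) ℚ.* v V x)
      -- Averaging happens within the top `k` ranks; items beyond `k` that beat the reference only
      -- increase `better m`, as values are positive.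
      average : ∀ m → topBetter m ℚ.* O ℚ.≤ K ℚ.* better m
      average m = ℚ.≤-trans
        (prefix-average m k (v V) (λ 1≤x x≤y y≤k → antitone V 1≤x x≤y (≤-trans y≤k k≤n)))
        (ℚ.*-monoˡ-≤-nonNeg K ⦃ nonNegative (0≤fromℕℚ k) ⦄
          (∑-ranks-mono k≤n (λ {x} x∈ → 0≤* (0≤ind (x <ᵇ m)) (ℚ.<⇒≤ (positive V x (∈-ranks⇒1≤ x∈) (∈-ranks⇒≤ x∈))))))

    formula≤ratio : ρ ℚ.≤ ratio n k accepted V
    formula≤ratio = ℚ.*-cancelʳ-≤-pos (K ℚ.* N ℚ.* O) ⦃ ℚ.positive (0<* (0<* 0<K 0<N) 0<OPT) ⦄ (begin
      ρ ℚ.* (K ℚ.* N ℚ.* O)                         ≡⟨ ℚ.*-assoc ρ (K ℚ.* N) O ⟨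
      ρ ℚ.* (K ℚ.* N) ℚ.* O                         ≡⟨ cong (ℚ._* O) formula-score ⟩
      score ℚ.* O                                   ≤⟨ score-OPT≤ ⟩
      total V ℚ.* K                                 ≡⟨ cong (ℚ._* K) ratio-total ⟨
      ratio n k accepted V ℚ.* (O ℚ.* N) ℚ.* K      ≡⟨ solve 4 (λ a o n k → a :* (o :* n) :* k := a :* (k :* n :* o)) refl (ratio n k accepted V) O N K ⟩
      ratio n k accepted V ℚ.* (K ℚ.* N ℚ.* O)      ∎)
      where
      open ℚ.≤-Reasoning
      open +-*-Solver

  -- A bound, free of δ, for the contribution of the slope of `nearlyFlat`: whatever `m` is, the
  -- slope is summed over all ranks instead of those below `m`.
  excess : ℚ
  excess = ∑ (ranks n) (λ m → coeff m ℚ.* ∑ (ranks n) (λ x → fromℕℚ (suc n ∸ x)))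

  module _ (δ : ℚ) (0<δ : 0ℚ ℚ.< δ) where

    private
      V : Values n
      V = nearlyFlat n k δ 0<δ

    K≤OPT : K ℚ.≤ OPT n k V
    K≤OPT = begin
      K                          ≡⟨ ∑-ranks-one k ⟨
      ∑ (ranks k) (λ _ → 1ℚ)     ≤⟨ ∑-mono-∈ (ranks k) (λ {x} x∈ → begin
        1ℚ                       ≡⟨ ind-T (≤⇒≤ᵇ (∈-ranks⇒≤ x∈)) ⟨
        ind (x ≤ᵇ k)             ≡⟨ ℚ.+-identityʳ (ind (x ≤ᵇ k)) ⟨
        ind (x ≤ᵇ k) ℚ.+ 0ℚ      ≤⟨ ℚ.+-monoʳ-≤ (ind (x ≤ᵇ k)) (0≤* (ℚ.<⇒≤ 0<δ) (0≤fromℕℚ (suc n ∸ x))) ⟩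
        v V x                    ∎) ⟩
      OPT n k V                  ∎
      where
      open ℚ.≤-Reasoning

    total≤ : total V ℚ.≤ score ℚ.+ δ ℚ.* excess
    total≤ = begin
      total V
        ≡⟨ ∑-accepted (v V) ⟩
      ∑ (ranks n) (λ m → coeff m ℚ.* ∑ (ranks n) (λ x → ind (x <ᵇ m) ℚ.* v V x))
        ≤⟨ ∑-mono-∈ (ranks n) (λ {m} _ → ℚ.*-monoˡ-≤-nonNeg (coeff m) ⦃ nonNegative (0≤coeff m) ⦄ (better≤ m)) ⟩
      ∑ (ranks n) (λ m → coeff m ℚ.* (topBetter m ℚ.+ δ ℚ.* M))
        ≡⟨ ∑-cong (ranks n) (λ m → solve 4 (λ c l d e → c :* (l :+ d :* e) := c :* l :+ d :* (c :* e)) refl (coeff m) (topBetter m) δ M) ⟩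
      ∑ (ranks n) (λ m → coeff m ℚ.* topBetter m ℚ.+ δ ℚ.* (coeff m ℚ.* M))
        ≡⟨ ∑-distrib-+ (ranks n) (λ m → coeff m ℚ.* topBetter m) (λ m → δ ℚ.* (coeff m ℚ.* M)) ⟩
      score ℚ.+ ∑ (ranks n) (λ m → δ ℚ.* (coeff m ℚ.* M))
        ≡⟨ cong (score ℚ.+_) (∑-distribˡ-* (ranks n) δ (λ m → coeff m ℚ.* M)) ⟨
      score ℚ.+ δ ℚ.* excess ∎
      where
      open ℚ.≤-Reasoning
      open +-*-Solver
      M : ℚ
      M = ∑ (ranks n) (λ x → fromℕℚ (suc n ∸ x))
      better≤ : ∀ m → ∑ (ranks n) (λ x → ind (x <ᵇ m) ℚ.* v V x) ℚ.≤ topBetter m ℚ.+ δ ℚ.* M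
      better≤ m = begin
        ∑ (ranks n) (λ x → ind (x <ᵇ m) ℚ.* v V x)
          ≤⟨ ∑-mono-∈ (ranks n) (λ {x} _ → let d = δ ℚ.* fromℕℚ (suc n ∸ x) in begin
               ind (x <ᵇ m) ℚ.* (ind (x ≤ᵇ k) ℚ.+ d)
                 ≡⟨ solve 3 (λ a b c → a :* (b :+ c) := b :* a :+ a :* c) refl (ind (x <ᵇ m)) (ind (x ≤ᵇ k)) d ⟩
               ind (x ≤ᵇ k) ℚ.* ind (x <ᵇ m) ℚ.+ ind (x <ᵇ m) ℚ.* d
                 ≤⟨ ℚ.+-monoʳ-≤ (ind (x ≤ᵇ k) ℚ.* ind (x <ᵇ m)) (ℚ.*-monoʳ-≤-nonNeg d
                      ⦃ nonNegative (0≤* (ℚ.<⇒≤ 0<δ) (0≤fromℕℚ (suc n ∸ x))) ⦄ (ind≤1 (x <ᵇ m))) ⟩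
               ind (x ≤ᵇ k) ℚ.* ind (x <ᵇ m) ℚ.+ 1ℚ ℚ.* d
                 ≡⟨ cong (ind (x ≤ᵇ k) ℚ.* ind (x <ᵇ m) ℚ.+_) (ℚ.*-identityˡ d) ⟩
               ind (x ≤ᵇ k) ℚ.* ind (x <ᵇ m) ℚ.+ d ∎) ⟩
        ∑ (ranks n) (λ x → ind (x ≤ᵇ k) ℚ.* ind (x <ᵇ m) ℚ.+ δ ℚ.* fromℕℚ (suc n ∸ x))
          ≡⟨ ∑-distrib-+ (ranks n) (λ x → ind (x ≤ᵇ k) ℚ.* ind (x <ᵇ m)) (λ x → δ ℚ.* fromℕℚ (suc n ∸ x)) ⟩
        ∑ (ranks n) (λ x → ind (x ≤ᵇ k) ℚ.* ind (x <ᵇ m)) ℚ.+ ∑ (ranks n) (λ x → δ ℚ.* fromℕℚ (suc n ∸ x))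
          ≡⟨ cong₂ ℚ._+_ (∑-ranks-≤ᵇ k≤n (λ x → ind (x <ᵇ m))) (sym (∑-distribˡ-* (ranks n) δ (λ x → fromℕℚ (suc n ∸ x)))) ⟩
        topBetter m ℚ.+ δ ℚ.* M ∎

    ratio-nearlyFlat< : ∀ {ε} → 0ℚ ℚ.< ε → δ ℚ.* excess ℚ.< ε ℚ.* (K ℚ.* N) →
      ratio n k accepted V ℚ.< ρ ℚ.+ ε
    ratio-nearlyFlat< {ε} 0<ε small = ℚ.*-cancelʳ-<-nonNeg (O V ℚ.* N) ⦃ nonNegative 0≤ON ⦄ (begin-strict
      ratio n k accepted V ℚ.* (O V ℚ.* N)   ≡⟨ ratio-total V ⟩
      total V                                ≤⟨ total≤ ⟩
      score ℚ.+ δ ℚ.* excess                 <⟨ ℚ.+-monoʳ-< score small ⟩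
      score ℚ.+ ε ℚ.* (K ℚ.* N)              ≡⟨ cong (ℚ._+ ε ℚ.* (K ℚ.* N)) formula-score ⟨
      ρ ℚ.* (K ℚ.* N) ℚ.+ ε ℚ.* (K ℚ.* N)    ≡⟨ ℚ.*-distribʳ-+ (K ℚ.* N) ρ ε ⟨
      -- The optimum of `nearlyFlat` is at least `k`; replacing `K` by it increases the product
      -- because `ρ` + `ε` is non-negative.
      (ρ ℚ.+ ε) ℚ.* (K ℚ.* N)                ≤⟨ ℚ.*-monoˡ-≤-nonNeg (ρ ℚ.+ ε) ⦃ nonNegative (ℚ.+-mono-≤ 0≤ρ (ℚ.<⇒≤ 0<ε)) ⦄
                                                  (ℚ.*-monoʳ-≤-nonNeg N ⦃ nonNegative (ℚ.<⇒≤ 0<N) ⦄ K≤OPT) ⟩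
      (ρ ℚ.+ ε) ℚ.* (O V ℚ.* N)              ∎)
      where
      open ℚ.≤-Reasoning
      0≤ON : 0ℚ ℚ.≤ O V ℚ.* N
      0≤ON = ℚ.<⇒≤ (0<* (0<OPT V) 0<N)
      0≤ρ : 0ℚ ℚ.≤ ρ
      0≤ρ = ℚ.*-cancelʳ-≤-pos (K ℚ.* N) ⦃ ℚ.positive (0<* 0<K 0<N) ⦄
        (subst (ℚ._≤ ρ ℚ.* (K ℚ.* N)) (sym (ℚ.*-zeroˡ (K ℚ.* N)))
          (subst (0ℚ ℚ.≤_) (sym formula-score) (∑-nonneg (ranks n) (λ {m} _ → 0≤* (0≤coeff m) (0≤topBetter m)))))

  formula-approximated : ∀ ε → 0ℚ ℚ.< ε → Σ (Values n) (λ V → ratio n k accepted V ℚ.< ρ ℚ.+ ε)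
  formula-approximated ε 0<ε = nearlyFlat n k δ 0<δ , ratio-nearlyFlat< δ 0<δ 0<ε small
    where
    open ℚ.≤-Reasoning
    open +-*-Solver
    target denominator δ : ℚ
    target = ε ℚ.* (K ℚ.* N)
    -- The added 1 keeps the divisor positive even if `excess` is 0, and it makes `small` strict,
    -- with δ itself as the margin.
    denominator = excess ℚ.+ 1ℚ
    δ = target ÷' denominator
    0<target : 0ℚ ℚ.< target
    0<target = 0<* 0<ε (0<* 0<K 0<N)
    0<denominator : 0ℚ ℚ.< denominator
    0<denominator = ℚ.+-mono-≤-< (∑-nonneg (ranks n) (λ {m} _ → 0≤* (0≤coeff m)
      (∑-nonneg (ranks n) (λ {x} _ → 0≤fromℕℚ (suc n ∸ x))))) (ℚ.positive⁻¹ 1ℚ)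
    δ-denominator : δ ℚ.* denominator ≡ target
    δ-denominator = ÷'-* target 0<denominator
    0<δ : 0ℚ ℚ.< δ
    0<δ = ℚ.*-cancelʳ-<-nonNeg denominator ⦃ nonNegative (ℚ.<⇒≤ 0<denominator) ⦄
      (subst (ℚ._< δ ℚ.* denominator) (sym (ℚ.*-zeroˡ denominator)) (subst (0ℚ ℚ.<_) (sym δ-denominator) 0<target))
    small : δ ℚ.* excess ℚ.< target
    small = begin-strict
      δ ℚ.* excess             ≡⟨ ℚ.+-identityʳ (δ ℚ.* excess) ⟨
      δ ℚ.* excess ℚ.+ 0ℚ      <⟨ ℚ.+-monoʳ-< (δ ℚ.* excess) 0<δ ⟩
      δ ℚ.* excess ℚ.+ δ       ≡⟨ solve 2 (λ d b → d :* b :+ d := d :* (b :+ con 1ℚ)) refl δ excess ⟩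
      δ ℚ.* denominator        ≡⟨ δ-denominator ⟩
      target                   ∎

theorem10 : (n k r t : ℕ) → 1 ≤ n → 1 ≤ k → 1 ≤ r → r ≤ k → k < t → t ≤ n ∸ k →
    IsCompetitiveRatio n k (singleRef k t r) (formula n k t r)
theorem10 n k (suc q) (suc u) _ _ _ r≤k (s≤s k≤u) t≤n∸k = formula≤ratio , formula-approximated
  where
  u≤n : u ≤ n
  u≤n = ≤-trans (ℕ.n≤1+n u) (≤-trans t≤n∸k (ℕ.m∸n≤m n k))
  open Ratio n k q u r≤k (≤-trans r≤k k≤u) u≤n (≤-trans k≤u u≤n)
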